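{- For every integer $d\geq 2$, $k(d,\,2^{d-1}+1-d)=1$. In other words, every $2$-neighborly centrally symmetric $d$-dimensional polytope has at most $2^{d}$ vertices.
   Context: A polytope $P\subset\mathbb{R}^d$ (convex hull of finitely many points) is centrally symmetric (cs) if $x\in P$ implies $-x\in P$. A $d$-polytope is a polytope of dimension $d$. A cs polytope $P$ with $2m$ vertices is called $k$-neighborly, where $1\le k\le m$ is an integer, if every set of $k$ of its vertices, no two of which are antipodal (i.e. no two of the form $v,-v$), is the vertex set of a face of $P$. For integers $d\ge 2$, $n\ge 1$, $k(d,n)$ denotes the largest integer $k$ such that there exists a $k$-neighborly cs $d$-polytope with exactly $2(n+d)$ vertices. -}

module Defs where

open import Data.Fin.Base using (Fin)
open import Data.Nat.Base as ℕ using (ℕ; suc)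
import Data.Nat.Properties as ℕₚ
open import Data.Product using (Σ-syntax; ∃; ∃-syntax; _×_; _,_; proj₁; proj₂)
open import Data.Rational.Base as ℚ using (ℚ; 0ℚ; 1ℚ; ½)
import Data.Rational.Properties as ℚₚ
open import Data.Rational.Solver using (module +-*-Solver)
open import Data.Vec.Functional as Vector using (Vector)
open import Data.Vec.Functional.Relation.Binary.Pointwise using (Pointwise)
open import Function.Bundles using (_⇔_)
open import Function.Definitions using (Injective)
open import Level using (0ℓ)
open import Relation.Binary.PropositionalEquality
  using (_≡_; _≢_; refl; sym; cong; subst; module ≡-Reasoning)
open import Relation.Nullary using (¬_)
open import Relation.Unary using (Pred; _∈_; _⊆_; _≐_)

------------------------------------------------------------------------
-- The real numbers: Cauchy sequences of rationals, compared by the setoid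
-- equality _≈_ rather than quotiented.

Eventually : Pred ℕ 0ℓ → Set
Eventually Q = ∃[ N ] ∀ n → N ℕ.≤ n → Q n

Cauchy : (ℕ → ℚ) → Set
Cauchy s = ∀ ε → 0ℚ ℚ.< ε →
  ∃[ N ] ∀ m n → N ℕ.≤ m → N ℕ.≤ n → ℚ.∣ s m ℚ.- s n ∣ ℚ.< ε

record ℝ : Set where
  constructor mkℝ
  field
    seq    : ℕ → ℚ
    cauchy : Cauchy seq

open ℝ public

infix 4 _≈_ _≤_

record _≈_ (x y : ℝ) : Set where
  constructor mk≈
  field
    close : ∀ ε → 0ℚ ℚ.< ε →
            Eventually λ n → ℚ.∣ seq x n ℚ.- seq y n ∣ ℚ.< ε

record _≤_ (x y : ℝ) : Set where
  constructor mk≤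
  field
    below : ∀ ε → 0ℚ ℚ.< ε →
            Eventually λ n → seq x n ℚ.< seq y n ℚ.+ ε

open _≈_ public
open _≤_ public

private
  open +-*-Solver

  halves : ∀ e → ½ ℚ.* e ℚ.+ ½ ℚ.* e ≡ e
  halves = solve 1 (λ e → con ½ :* e :+ con ½ :* e := e) refl

  split : ∀ a b → a ≡ (a ℚ.- b) ℚ.+ b
  split = solve 2 (λ a b → a := (a :- b) :+ b) refl

  neg-diff : ∀ a b → b ℚ.- a ≡ (ℚ.- a) ℚ.- (ℚ.- b)
  neg-diff = solve 2 (λ a b → b :- a := (:- a) :- (:- b)) refl

  +-diff : ∀ a b c d → (a ℚ.+ b) ℚ.- (c ℚ.+ d) ≡ (a ℚ.- c) ℚ.+ (b ℚ.- d)
  +-diff = solve 4 (λ a b c d → (a :+ b) :- (c :+ d) := (a :- c) :+ (b :- d)) refl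

  *-diff : ∀ a b c d →
           a ℚ.* b ℚ.- c ℚ.* d ≡ a ℚ.* (b ℚ.- d) ℚ.+ d ℚ.* (a ℚ.- c)
  *-diff = solve 4 (λ a b c d → a :* b :- c :* d := a :* (b :- d) :+ d :* (a :- c)) refl

  divide : ∀ C ε → 0ℚ ℚ.< C → 0ℚ ℚ.< ε → ∃[ δ ] 0ℚ ℚ.< δ × C ℚ.* δ ≡ ε
  divide C ε C>0 ε>0 = r ℚ.* ε , rε>0 , (begin
    C ℚ.* (r ℚ.* ε)  ≡⟨ ℚₚ.*-assoc C r ε ⟨
    (C ℚ.* r) ℚ.* ε  ≡⟨ cong (ℚ._* ε) (ℚₚ.*-inverseʳ C) ⟩
    1ℚ ℚ.* ε         ≡⟨ ℚₚ.*-identityˡ ε ⟩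
    ε                ∎)
    where
    open ≡-Reasoning
    instance
      C-pos = ℚ.positive C>0
      C≢0   = ℚₚ.pos⇒nonZero C
    r = ℚ.1/ C
    rε>0 : 0ℚ ℚ.< r ℚ.* ε
    rε>0 = subst (ℚ._< r ℚ.* ε) (ℚₚ.*-zeroʳ r)
             (ℚₚ.*-monoʳ-<-pos r {{ℚₚ.1/pos⇒pos C}} ε>0)

  -- Abstract, so that normalising a real never unfolds its Cauchy proof.
  abstract
    const-cauchy : ∀ q → Cauchy (λ _ → q)
    const-cauchy q ε ε>0 =
      0 , λ _ _ _ _ → subst (ℚ._< ε) (sym (cong ℚ.∣_∣ (ℚₚ.+-inverseʳ q))) ε>0

    +-bound : ∀ {δ} a b c d → ℚ.∣ a ℚ.- c ∣ ℚ.< δ → ℚ.∣ b ℚ.- d ∣ ℚ.< δ →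
              ℚ.∣ (a ℚ.+ b) ℚ.- (c ℚ.+ d) ∣ ℚ.< δ ℚ.+ δ
    +-bound {δ} a b c d a-c<δ b-d<δ = begin-strict
      ℚ.∣ (a ℚ.+ b) ℚ.- (c ℚ.+ d) ∣
        ≡⟨ cong ℚ.∣_∣ (+-diff a b c d) ⟩
      ℚ.∣ (a ℚ.- c) ℚ.+ (b ℚ.- d) ∣
        ≤⟨ ℚₚ.∣p+q∣≤∣p∣+∣q∣ (a ℚ.- c) (b ℚ.- d) ⟩
      ℚ.∣ a ℚ.- c ∣ ℚ.+ ℚ.∣ b ℚ.- d ∣
        <⟨ ℚₚ.+-mono-< a-c<δ b-d<δ ⟩
      δ ℚ.+ δ ∎
      where open ℚₚ.≤-Reasoning

    +-cauchy : ∀ {s t} → Cauchy s → Cauchy t → Cauchy (λ n → s n ℚ.+ t n)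
    +-cauchy {s} {t} cs ct ε ε>0 =
      let δ>0         = ℚₚ.*-monoʳ-<-pos ½ ε>0
          M , s-close = cs (½ ℚ.* ε) δ>0
          N , t-close = ct (½ ℚ.* ε) δ>0
      in M ℕ.⊔ N , λ m n K≤m K≤n →
        subst (ℚ.∣ (s m ℚ.+ t m) ℚ.- (s n ℚ.+ t n) ∣ ℚ.<_) (halves ε)
          (+-bound (s m) (t m) (s n) (t n)
            (s-close m n (ℕₚ.m⊔n≤o⇒m≤o M N K≤m) (ℕₚ.m⊔n≤o⇒m≤o M N K≤n))
            (t-close m n (ℕₚ.m⊔n≤o⇒n≤o M N K≤m) (ℕₚ.m⊔n≤o⇒n≤o M N K≤n)))

    neg-cauchy : ∀ {s} → Cauchy s → Cauchy (λ n → ℚ.- s n)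
    neg-cauchy {s} cs ε ε>0 = proj₁ (cs ε ε>0) , λ m n N≤m N≤n →
      subst (ℚ._< ε)
        (cong ℚ.∣_∣ (neg-diff (s m) (s n)))
        (proj₂ (cs ε ε>0) n m N≤n N≤m)

    near-bound : ∀ a b → ℚ.∣ a ℚ.- b ∣ ℚ.< 1ℚ → ℚ.∣ a ∣ ℚ.< 1ℚ ℚ.+ ℚ.∣ b ∣
    near-bound a b a-b<1 = begin-strict
      ℚ.∣ a ∣
        ≡⟨ cong ℚ.∣_∣ (split a b) ⟩
      ℚ.∣ (a ℚ.- b) ℚ.+ b ∣
        ≤⟨ ℚₚ.∣p+q∣≤∣p∣+∣q∣ (a ℚ.- b) b ⟩
      ℚ.∣ a ℚ.- b ∣ ℚ.+ ℚ.∣ b ∣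
        <⟨ ℚₚ.+-monoˡ-< ℚ.∣ b ∣ a-b<1 ⟩
      1ℚ ℚ.+ ℚ.∣ b ∣ ∎
      where open ℚₚ.≤-Reasoning

    eventually-bounded : ∀ {s} → Cauchy s →
      ∃[ B ] 0ℚ ℚ.< B × Eventually λ n → ℚ.∣ s n ∣ ℚ.< B
    eventually-bounded {s} cs =
      let N , close = cs 1ℚ (ℚₚ.positive⁻¹ 1ℚ)
      in 1ℚ ℚ.+ ℚ.∣ s N ∣ ,
         ℚₚ.+-mono-<-≤ (ℚₚ.positive⁻¹ 1ℚ) (ℚₚ.0≤∣p∣ (s N)) ,
         N , λ n N≤n → near-bound (s n) (s N) (close n N N≤n ℕₚ.≤-refl)

    *-mono-abs : ∀ {B δ} p q → 0ℚ ℚ.< B → ℚ.∣ p ∣ ℚ.< B → ℚ.∣ q ∣ ℚ.< δ →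
                 ℚ.∣ p ℚ.* q ∣ ℚ.< B ℚ.* δ
    *-mono-abs {B} {δ} p q B>0 p<B q<δ = begin-strict
      ℚ.∣ p ℚ.* q ∣         ≡⟨ ℚₚ.∣p*q∣≡∣p∣*∣q∣ p q ⟩
      ℚ.∣ p ∣ ℚ.* ℚ.∣ q ∣   ≤⟨ ℚₚ.*-monoʳ-≤-nonNeg ℚ.∣ q ∣
                                 {{ℚₚ.∣-∣-nonNeg q}} (ℚₚ.<⇒≤ p<B) ⟩
      B ℚ.* ℚ.∣ q ∣         <⟨ ℚₚ.*-monoʳ-<-pos B {{ℚ.positive B>0}} q<δ ⟩
      B ℚ.* δ               ∎
      where open ℚₚ.≤-Reasoning

    *-bound : ∀ {A B δ} a b c d → 0ℚ ℚ.< A → 0ℚ ℚ.< B →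
              ℚ.∣ a ∣ ℚ.< A → ℚ.∣ b ℚ.- d ∣ ℚ.< δ →
              ℚ.∣ d ∣ ℚ.< B → ℚ.∣ a ℚ.- c ∣ ℚ.< δ →
              ℚ.∣ a ℚ.* b ℚ.- c ℚ.* d ∣ ℚ.< (A ℚ.+ B) ℚ.* δ
    *-bound {A} {B} {δ} a b c d A>0 B>0 a<A b-d<δ d<B a-c<δ = begin-strict
      ℚ.∣ a ℚ.* b ℚ.- c ℚ.* d ∣
        ≡⟨ cong ℚ.∣_∣ (*-diff a b c d) ⟩
      ℚ.∣ a ℚ.* (b ℚ.- d) ℚ.+ d ℚ.* (a ℚ.- c) ∣
        ≤⟨ ℚₚ.∣p+q∣≤∣p∣+∣q∣ (a ℚ.* (b ℚ.- d)) (d ℚ.* (a ℚ.- c)) ⟩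
      ℚ.∣ a ℚ.* (b ℚ.- d) ∣ ℚ.+ ℚ.∣ d ℚ.* (a ℚ.- c) ∣
        <⟨ ℚₚ.+-mono-< (*-mono-abs a (b ℚ.- d) A>0 a<A b-d<δ)
                       (*-mono-abs d (a ℚ.- c) B>0 d<B a-c<δ) ⟩
      A ℚ.* δ ℚ.+ B ℚ.* δ
        ≡⟨ ℚₚ.*-distribʳ-+ δ A B ⟨
      (A ℚ.+ B) ℚ.* δ ∎
      where open ℚₚ.≤-Reasoning

    ⊔≤⇒all≤ : ∀ i j k l {m} → (i ℕ.⊔ j) ℕ.⊔ (k ℕ.⊔ l) ℕ.≤ m →
              i ℕ.≤ m × j ℕ.≤ m × k ℕ.≤ m × l ℕ.≤ m
    ⊔≤⇒all≤ i j k l h =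
      let ij = ℕₚ.m⊔n≤o⇒m≤o (i ℕ.⊔ j) (k ℕ.⊔ l) h
          kl = ℕₚ.m⊔n≤o⇒n≤o (i ℕ.⊔ j) (k ℕ.⊔ l) h
      in ℕₚ.m⊔n≤o⇒m≤o i j ij , ℕₚ.m⊔n≤o⇒n≤o i j ij ,
         ℕₚ.m⊔n≤o⇒m≤o k l kl , ℕₚ.m⊔n≤o⇒n≤o k l kl

    *-cauchy : ∀ {s t} → Cauchy s → Cauchy t → Cauchy (λ n → s n ℚ.* t n)
    *-cauchy {s} {t} cs ct ε ε>0 =
      let A , A>0 , I , s<A = eventually-bounded cs
          B , B>0 , J , t<B = eventually-bounded ct
          δ , δ>0 , Cδ≡ε    = divide (A ℚ.+ B) ε (ℚₚ.+-mono-< A>0 B>0) ε>0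
          M , s-close       = cs δ δ>0
          N , t-close       = ct δ δ>0
      in (I ℕ.⊔ J) ℕ.⊔ (M ℕ.⊔ N) , λ m n K≤m K≤n →
        let I≤m , _ , M≤m , N≤m = ⊔≤⇒all≤ I J M N K≤m
            _ , J≤n , M≤n , N≤n = ⊔≤⇒all≤ I J M N K≤n
        in subst (ℚ.∣ s m ℚ.* t m ℚ.- s n ℚ.* t n ∣ ℚ.<_) Cδ≡ε
             (*-bound (s m) (t m) (s n) (t n) A>0 B>0
               (s<A m I≤m) (t-close m n N≤m N≤n)
               (t<B n J≤n) (s-close m n M≤m M≤n))

infix  8 -_
infixl 7 _*_
infixl 6 _+_

fromℚ : ℚ → ℝ
fromℚ q = mkℝ (λ _ → q) (const-cauchy q)

0ℝ 1ℝ : ℝ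
0ℝ = fromℚ 0ℚ
1ℝ = fromℚ 1ℚ

_+_ _*_ : ℝ → ℝ → ℝ
x + y = mkℝ (λ n → seq x n ℚ.+ seq y n) (+-cauchy {seq x} {seq y} (cauchy x) (cauchy y))
x * y = mkℝ (λ n → seq x n ℚ.* seq y n) (*-cauchy {seq x} {seq y} (cauchy x) (cauchy y))

-_ : ℝ → ℝ
- x = mkℝ (λ n → ℚ.- seq x n) (neg-cauchy {seq x} (cauchy x))

sum : ∀ {n} → Vector ℝ n → ℝ
sum = Vector.foldr _+_ 0ℝ

------------------------------------------------------------------------
-- Points of ℝᵈ

Point : ℕ → Set
Point d = Vector ℝ d

infix 4 _≋_
infix 8 -ᵛ_
infix 7 _∙_

_≋_ : ∀ {d} → Point d → Point d → Set
_≋_ = Pointwise _≈_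

-ᵛ_ : ∀ {d} → Point d → Point d
-ᵛ_ = Vector.map -_

0ᵛ : ∀ {d} → Point d
0ᵛ = Vector.replicate _ 0ℝ

_∙_ : ∀ {d} → Point d → Point d → ℝ
a ∙ x = sum (Vector.zipWith _*_ a x)

combination : ∀ {d n} → Vector ℝ n → Vector (Point d) n → Point d
combination μ p j = sum λ i → μ i * p i j

ConvexHull : ∀ {d n} → Vector (Point d) n → Pred (Point d) 0ℓ
ConvexHull p x = ∃[ μ ] (∀ i → 0ℝ ≤ μ i) × sum μ ≈ 1ℝ × combination μ p ≋ x

AffineHull : ∀ {d n} → Vector (Point d) n → Pred (Point d) 0ℓ
AffineHull p x = ∃[ μ ] sum μ ≈ 1ℝ × combination μ p ≋ x

AffinelyIndependent : ∀ {d n} → Vector (Point d) n → Set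
AffinelyIndependent p =
  ∀ μ → sum μ ≈ 0ℝ → combination μ p ≋ 0ᵛ → ∀ i → μ i ≈ 0ℝ

-- The dimension of a set is that of its affine hull, witnessed by an affine
-- basis chosen inside the set.
HasDimension : ∀ {d} → Pred (Point d) 0ℓ → ℕ → Set
HasDimension {d} X k = Σ[ p ∈ Vector (Point d) (suc k) ]
  (∀ i → p i ∈ X) × AffinelyIndependent p × X ⊆ AffineHull p

------------------------------------------------------------------------
-- Polytopes

record Polytope (d : ℕ) : Set where
  field
    size       : ℕ
    generators : Vector (Point d) size

  carrier : Pred (Point d) 0ℓ
  carrier = ConvexHull generators

open Polytope public using (carrier)

-- The intersection of X with { x ∣ normal ∙ x = offset }, where
-- normal ∙ x ≤ offset is valid on X.  The normal may be 0, so X itself and the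
-- empty set are faces.
record Face {d} (X : Pred (Point d) 0ℓ) : Set where
  field
    normal : Point d
    offset : ℝ
    valid  : ∀ {x} → x ∈ X → normal ∙ x ≤ offset

  points : Pred (Point d) 0ℓ
  points x = x ∈ X × normal ∙ x ≈ offset

open Face public using (points)

IsVertex : ∀ {d} → Pred (Point d) 0ℓ → Pred (Point d) 0ℓ
IsVertex X v = ∃[ F ] points {X = X} F ≐ (_≋ v)

VertexSetIs : ∀ {d n} → Pred (Point d) 0ℓ → Vector (Point d) n → Set
VertexSetIs X v = ∀ x → IsVertex X x ⇔ (∃[ i ] x ≋ v i)

HasVertexCount : ∀ {d} → Pred (Point d) 0ℓ → ℕ → Set
HasVertexCount {d} X N =
  Σ[ v ∈ Vector (Point d) N ] Injective _≡_ _≋_ v × VertexSetIs X v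

CentrallySymmetric : ∀ {d} → Polytope d → Set
CentrallySymmetric P = ∀ x → x ∈ carrier P → -ᵛ x ∈ carrier P

-- P is a cs polytope with 2m vertices which is k-neighborly.
record Neighborly {d} (k m : ℕ) (P : Polytope d) : Set where
  field
    symmetric   : CentrallySymmetric P
    vertexCount : HasVertexCount (carrier P) (2 ℕ.* m)
    1≤k         : 1 ℕ.≤ k
    k≤m         : k ℕ.≤ m
    faces       : (w : Vector (Point d) k) → Injective _≡_ _≋_ w →
                  (∀ i → w i ∈ IsVertex (carrier P)) →
                  (∀ i j → i ≢ j → ¬ w i ≋ -ᵛ w j) →
                  Σ[ F ∈ Face (carrier P) ] VertexSetIs (points F) w

NeighborlyExists : (d n k : ℕ) → Set
NeighborlyExists d n k =
  Σ[ P ∈ Polytope d ] HasDimension (carrier P) d × Neighborly k (n ℕ.+ d) P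

IsLargest : Pred ℕ 0ℓ → Pred ℕ 0ℓ
IsLargest Q k = k ∈ Q × (∀ j → j ∈ Q → j ℕ.≤ k)

-- k(d,n) = k, stated relationally because k(d,n) is defined as a maximum.
k[_,_]≔_ : (d n k : ℕ) → Set
k[ d , n ]≔ k = IsLargest (NeighborlyExists d n) k

{-# OPTIONS --safe #-}

-- Upper bound.  Let v ≠ w be vertices of P.  The points v and -w lie on a
-- proper face { a ∙ x = c } of P (if w = -v, the face {v}), and |a ∙ x| ≤ c on P
-- by symmetry, so a ∙ (v - w) = 2c: the vertices have pairwise distance 2 in the
-- norm with unit ball P.  The classical proof compares the volumes of the
-- translates P + v with that of 2P.  Here volume is replaced by counting: the
-- Nᵏ points Σ_{t<k} 2ᵗ v(sₜ) again have pairwise distance at least 2, and lie in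
-- a box of side O(2ᵏ), so by the pigeonhole principle Nᵏ ≤ C (2ᵈ)ᵏ for every k,
-- whence N ≤ 2ᵈ.  The count is made on rational approximations; that the offsets
-- c are bounded away from 0 is known only up to double negation, which is enough
-- for a decidable conclusion.
--
-- Existence.  The cube [-1,1]ᵈ and the two points ±2e₀ span a centrally
-- symmetric polytope with 2ᵈ + 2 vertices.

module Submission where

open import Defs using (Polytope; carrier; HasDimension; Neighborly; k[_,_]≔_)
open import Algebra.Bundles using (CommutativeRing)
open import Data.Empty using (⊥)
open import Data.Fin.Base as Fin using (Fin; zero; suc; toℕ; remQuot; combine; funToFin; finToFun; splitAt; join)
import Data.Fin.Properties as Fin
open import Data.Integer.Base as ℤ using (ℤ; +_)
import Data.Integer.Properties as ℤ
open import Data.Nat.Base as ℕ using (ℕ; zero; suc; _^_; z≤n; s≤s; NonZero; >-nonZero⁻¹)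
import Data.Nat.Properties as ℕ
open import Data.Nat.Tactic.RingSolver using (solve-∀)
open import Data.Product using (Σ-syntax; ∃; ∃-syntax; _×_; _,_; proj₁; proj₂)
open import Data.Rational.Base as ℚ using (ℚ; 0ℚ; 1ℚ; ½)
import Data.Rational.Properties as ℚ
open import Data.Rational.Solver using (module +-*-Solver)
import Data.Rational.Unnormalised.Base as ℚᵘ
import Data.Rational.Unnormalised.Properties as ℚᵘ
open import Data.Sum.Base using (_⊎_; inj₁; inj₂; [_,_]′)
open import Data.Vec.Functional using (Vector; _∷_; [])
open import Function.Base using (_∘_)
open import Function.Bundles using (Equivalence; mk⇔)
open import Function.Definitions using (Injective)
open import Level using (0ℓ)
open import Relation.Binary.PropositionalEquality
  using (_≡_; _≢_; refl; sym; trans; cong; cong₂; subst; subst₂; module ≡-Reasoning)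
import Relation.Binary.Reasoning.Setoid as SetoidReasoning
open import Relation.Nullary using (¬_; Dec; yes; no; contradiction)
open import Relation.Nullary.Decidable using (decidable-stable; from-yes; _⊎-dec_)
open import Relation.Unary using (Pred; _∈_; _⊆_)
open import Algebra.Properties.Semiring.Sum (CommutativeRing.semiring ℚ.+-*-commutativeRing)
  using () renaming
    (sum to sumℚ; sum-cong-≗ to sumℚ-cong; ∑-distrib-+ to sumℚ-+; *-distribˡ-sum to *-distribˡ-sumℚ)
open +-*-Solver using (solve; _:=_; _:+_; _:*_; _:-_; :-_; con)

-- Distance 2 survives because the weights double. Let t be the highest place where two digit
-- strings differ. A functional separating those two digits gains 2·2ᵗ there, the higher places
-- cancel, and the lower places lose at most 2 per unit of weight, in total 2(2ᵗ - 1).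
--
-- The obstacle is that the order of Cauchy reals is undecidable, so a real point cannot be assigned
-- to a cell. Vertices and normals are therefore sampled at one common index, where the separating
-- inequalities hold only up to a tolerance η, and the error grows to 2ᵏ⁺¹η. This dictates the order
-- of quantifiers: the bound L on the normals and the bound M on the coordinates are fixed before k,
-- since they enter C = (L · 2M)ᵈ, whereas η and the sampling index depend on k.
--
-- For n = 2ᵈ⁻¹ + 1 - d the vertex number 2(n + d) is 2ᵈ + 2, the first even number above the bound.
-- Maximality of 1 must exclude every j ≥ 2, so the bound is proved for all such j at once.

module _ where

  open Defs

  -- Rational linear arithmetic: the equation says p − q = a − b without subtraction.
  lin≤ : ∀ {a b p q} → a ℚ.≤ b → p ℚ.+ b ≡ q ℚ.+ a → p ℚ.≤ q
  lin≤ {a} {b} {p} {q} a≤b eq = subst₂ ℚ._≤_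
    (trans (cong (ℚ._- b) (sym eq)) (cancel p b)) (cancel q b)
    (ℚ.+-monoˡ-≤ (ℚ.- b) (ℚ.+-monoʳ-≤ q a≤b))
    where
    cancel : ∀ x y → (x ℚ.+ y) ℚ.- y ≡ x
    cancel = solve 2 (λ x y → (x :+ y) :- y := x) refl

  lin< : ∀ {a b p q} → a ℚ.< b → p ℚ.+ b ≡ q ℚ.+ a → p ℚ.< q
  lin< {a} {b} {p} {q} a<b eq = subst₂ ℚ._<_
    (trans (cong (ℚ._- b) (sym eq)) (cancel p b)) (cancel q b)
    (ℚ.+-monoˡ-< (ℚ.- b) (ℚ.+-monoʳ-< q a<b))
    where
    cancel : ∀ x y → (x ℚ.+ y) ℚ.- y ≡ x
    cancel = solve 2 (λ x y → (x :+ y) :- y := x) refl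

  0<* : ∀ {p q} → 0ℚ ℚ.< p → 0ℚ ℚ.< q → 0ℚ ℚ.< p ℚ.* q
  0<* {p} {q} p>0 q>0 = subst (ℚ._< p ℚ.* q) (ℚ.*-zeroʳ p) (ℚ.*-monoʳ-<-pos p {{ℚ.positive p>0}} q>0)

  0≤* : ∀ {p q} → 0ℚ ℚ.≤ p → 0ℚ ℚ.≤ q → 0ℚ ℚ.≤ p ℚ.* q
  0≤* {p} {q} p≥0 q≥0 =
    subst (ℚ._≤ p ℚ.* q) (ℚ.*-zeroʳ p) (ℚ.*-monoˡ-≤-nonNeg p {{ℚ.nonNegative p≥0}} q≥0)

  0<½* : ∀ {ε} → 0ℚ ℚ.< ε → 0ℚ ℚ.< ½ ℚ.* ε
  0<½* = 0<* (ℚ.positive⁻¹ ½)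

  0<1ℚ : 0ℚ ℚ.< 1ℚ
  0<1ℚ = ℚ.positive⁻¹ 1ℚ

  divide : ∀ {C ε} → 0ℚ ℚ.< C → 0ℚ ℚ.< ε → ∃[ δ ] 0ℚ ℚ.< δ × C ℚ.* δ ≡ ε
  divide {C} {ε} C>0 ε>0 = r ℚ.* ε , 0<* (ℚ.positive⁻¹ r {{ℚ.1/pos⇒pos C}}) ε>0 ,
    trans (sym (ℚ.*-assoc C r ε)) (trans (cong (ℚ._* ε) (ℚ.*-inverseʳ C)) (ℚ.*-identityˡ ε))
    where
    instance
      C-pos = ℚ.positive C>0
      C≢0   = ℚ.pos⇒nonZero C
    r = ℚ.1/ C

  p≤∣p∣ : ∀ p → p ℚ.≤ ℚ.∣ p ∣
  p≤∣p∣ p with ℚ.≤-total 0ℚ p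
  ... | inj₁ 0≤p = ℚ.≤-reflexive (sym (ℚ.0≤p⇒∣p∣≡p 0≤p))
  ... | inj₂ p≤0 = ℚ.≤-trans p≤0 (ℚ.0≤∣p∣ p)

  -p≤∣p∣ : ∀ p → ℚ.- p ℚ.≤ ℚ.∣ p ∣
  -p≤∣p∣ p = subst (ℚ.- p ℚ.≤_) (ℚ.∣-p∣≡∣p∣ p) (p≤∣p∣ (ℚ.- p))

  ∣∣<-intro : ∀ {p ε} → p ℚ.< ε → ℚ.- p ℚ.< ε → ℚ.∣ p ∣ ℚ.< ε
  ∣∣<-intro {p} {ε} p<ε -p<ε with ℚ.∣p∣≡p∨∣p∣≡-p p
  ... | inj₁ eq = subst (ℚ._< ε) (sym eq) p<ε
  ... | inj₂ eq = subst (ℚ._< ε) (sym eq) -p<ε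

  ∣∣≤-intro : ∀ {p ε} → p ℚ.≤ ε → ℚ.- p ℚ.≤ ε → ℚ.∣ p ∣ ℚ.≤ ε
  ∣∣≤-intro {p} {ε} p≤ε -p≤ε with ℚ.∣p∣≡p∨∣p∣≡-p p
  ... | inj₁ eq = subst (ℚ._≤ ε) (sym eq) p≤ε
  ... | inj₂ eq = subst (ℚ._≤ ε) (sym eq) -p≤ε

  ∣-∣<⇒< : ∀ {p q ε} → ℚ.∣ p ℚ.- q ∣ ℚ.< ε → p ℚ.< q ℚ.+ ε
  ∣-∣<⇒< {p} {q} {ε} h = lin< (ℚ.≤-<-trans (p≤∣p∣ (p ℚ.- q)) h) (eq p q ε)
    where
    eq : ∀ p q ε → p ℚ.+ ε ≡ (q ℚ.+ ε) ℚ.+ (p ℚ.- q)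
    eq = solve 3 (λ p q ε → p :+ ε := (q :+ ε) :+ (p :- q)) refl

  ∣-∣-comm : ∀ p q → ℚ.∣ p ℚ.- q ∣ ≡ ℚ.∣ q ℚ.- p ∣
  ∣-∣-comm p q = trans (sym (ℚ.∣-p∣≡∣p∣ (p ℚ.- q))) (cong ℚ.∣_∣ (eq p q))
    where
    eq : ∀ p q → ℚ.- (p ℚ.- q) ≡ q ℚ.- p
    eq = solve 2 (λ p q → :- (p :- q) := q :- p) refl

  ∣*∣< : ∀ {B δ} p q → 0ℚ ℚ.< B → ℚ.∣ p ∣ ℚ.< B → ℚ.∣ q ∣ ℚ.< δ → ℚ.∣ p ℚ.* q ∣ ℚ.< B ℚ.* δ
  ∣*∣< {B} {δ} p q B>0 p<B q<δ = begin-strict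
    ℚ.∣ p ℚ.* q ∣          ≡⟨ ℚ.∣p*q∣≡∣p∣*∣q∣ p q ⟩
    ℚ.∣ p ∣ ℚ.* ℚ.∣ q ∣    ≤⟨ ℚ.*-monoʳ-≤-nonNeg ℚ.∣ q ∣ {{ℚ.∣-∣-nonNeg q}} (ℚ.<⇒≤ p<B) ⟩
    B ℚ.* ℚ.∣ q ∣          <⟨ ℚ.*-monoʳ-<-pos B {{ℚ.positive B>0}} q<δ ⟩
    B ℚ.* δ                ∎
    where open ℚ.≤-Reasoning

  -- Eventual statements and the ordered ring of Cauchy reals

  eventually-map : ∀ {P Q : Pred ℕ 0ℓ} → (∀ n → P n → Q n) → Eventually P → Eventually Q
  eventually-map f (N , p) = N , λ n N≤n → f n (p n N≤n)

  eventually-map₂ : ∀ {P Q R : Pred ℕ 0ℓ} → (∀ n → P n → Q n → R n) →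
                    Eventually P → Eventually Q → Eventually R
  eventually-map₂ f (M , p) (N , q) = M ℕ.⊔ N , λ n M⊔N≤n →
    f n (p n (ℕ.m⊔n≤o⇒m≤o M N M⊔N≤n)) (q n (ℕ.m⊔n≤o⇒n≤o M N M⊔N≤n))

  always : ∀ {P : Pred ℕ 0ℓ} → (∀ n → P n) → Eventually P
  always p = 0 , λ n _ → p n

  eventually-inhabited : ∀ {P : Pred ℕ 0ℓ} → Eventually P → ∃ P
  eventually-inhabited (N , p) = N , p N ℕ.≤-refl

  eventually-bounded : ∀ x → ∃[ B ] 0ℚ ℚ.< B × Eventually λ n → ℚ.∣ seq x n ∣ ℚ.< B
  eventually-bounded x =
    let N , near = cauchy x 1ℚ 0<1ℚ
    in 1ℚ ℚ.+ ℚ.∣ seq x N ∣ , ℚ.+-mono-<-≤ 0<1ℚ (ℚ.0≤∣p∣ (seq x N)) ,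
       N , λ n N≤n → bound (seq x n) (seq x N) (near n N N≤n ℕ.≤-refl)
    where
    split : ∀ a b → (a ℚ.- b) ℚ.+ b ≡ a
    split = solve 2 (λ a b → (a :- b) :+ b := a) refl
    bound : ∀ a b → ℚ.∣ a ℚ.- b ∣ ℚ.< 1ℚ → ℚ.∣ a ∣ ℚ.< 1ℚ ℚ.+ ℚ.∣ b ∣
    bound a b h = ℚ.≤-<-trans
      (subst (λ c → ℚ.∣ c ∣ ℚ.≤ ℚ.∣ a ℚ.- b ∣ ℚ.+ ℚ.∣ b ∣) (split a b) (ℚ.∣p+q∣≤∣p∣+∣q∣ (a ℚ.- b) b))
      (ℚ.+-monoˡ-< ℚ.∣ b ∣ h)

  ≤-refl : ∀ {x} → x ≤ x
  ≤-refl {x} = mk≤ λ ε ε>0 → always λ n → lin< ε>0 (eq (seq x n) ε)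
    where
    eq : ∀ a ε → a ℚ.+ ε ≡ (a ℚ.+ ε) ℚ.+ 0ℚ
    eq = solve 2 (λ a ε → a :+ ε := (a :+ ε) :+ con 0ℚ) refl

  ≤-trans : ∀ {x y z} → x ≤ y → y ≤ z → x ≤ z
  ≤-trans {x} {y} {z} x≤y y≤z = mk≤ λ ε ε>0 →
    eventually-map₂ (λ n p q → lin< (ℚ.+-mono-< p q) (eq (seq x n) (seq y n) (seq z n) ε))
      (below x≤y _ (0<½* ε>0)) (below y≤z _ (0<½* ε>0))
    where
    eq : ∀ a b c ε → a ℚ.+ ((b ℚ.+ ½ ℚ.* ε) ℚ.+ (c ℚ.+ ½ ℚ.* ε)) ≡ (c ℚ.+ ε) ℚ.+ (a ℚ.+ b)
    eq = solve 4 (λ a b c ε →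
      a :+ ((b :+ con ½ :* ε) :+ (c :+ con ½ :* ε)) := (c :+ ε) :+ (a :+ b)) refl

  ≤-antisym : ∀ {x y} → x ≤ y → y ≤ x → x ≈ y
  ≤-antisym {x} {y} x≤y y≤x = mk≈ λ ε ε>0 →
    eventually-map₂ (λ n p q → ∣∣<-intro (lin< p (eq₁ (seq x n) (seq y n) ε)) (lin< q (eq₂ (seq x n) (seq y n) ε)))
      (below x≤y ε ε>0) (below y≤x ε ε>0)
    where
    eq₁ : ∀ a b ε → (a ℚ.- b) ℚ.+ (b ℚ.+ ε) ≡ ε ℚ.+ a
    eq₁ = solve 3 (λ a b ε → (a :- b) :+ (b :+ ε) := ε :+ a) refl
    eq₂ : ∀ a b ε → ℚ.- (a ℚ.- b) ℚ.+ (a ℚ.+ ε) ≡ ε ℚ.+ b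
    eq₂ = solve 3 (λ a b ε → :- (a :- b) :+ (a :+ ε) := ε :+ b) refl

  ≈⇒≤ : ∀ {x y} → x ≈ y → x ≤ y
  ≈⇒≤ x≈y = mk≤ λ ε ε>0 → eventually-map (λ n → ∣-∣<⇒<) (close x≈y ε ε>0)

  ≈-sym : ∀ {x y} → x ≈ y → y ≈ x
  ≈-sym {x} {y} x≈y = mk≈ λ ε ε>0 →
    eventually-map (λ n → subst (ℚ._< ε) (∣-∣-comm (seq x n) (seq y n))) (close x≈y ε ε>0)

  ≈⇒≥ : ∀ {x y} → x ≈ y → y ≤ x
  ≈⇒≥ x≈y = ≈⇒≤ (≈-sym x≈y)

  ≈-refl : ∀ {x} → x ≈ x
  ≈-refl = ≤-antisym ≤-refl ≤-refl

  ≈-trans : ∀ {x y z} → x ≈ y → y ≈ z → x ≈ z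
  ≈-trans p q = ≤-antisym (≤-trans (≈⇒≤ p) (≈⇒≤ q)) (≤-trans (≈⇒≥ q) (≈⇒≥ p))

  ≤-pointwise : ∀ {x y} → Eventually (λ n → seq x n ℚ.≤ seq y n) → x ≤ y
  ≤-pointwise {x} {y} x≤y = mk≤ λ ε ε>0 →
    eventually-map (λ n p → lin< (ℚ.+-mono-≤-< p ε>0) (eq (seq x n) (seq y n) ε)) x≤y
    where
    eq : ∀ a b ε → a ℚ.+ (b ℚ.+ ε) ≡ (b ℚ.+ ε) ℚ.+ (a ℚ.+ 0ℚ)
    eq = solve 3 (λ a b ε → a :+ (b :+ ε) := (b :+ ε) :+ (a :+ con 0ℚ)) refl

  ≈-pointwise : ∀ {x y} → (∀ n → seq x n ≡ seq y n) → x ≈ y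
  ≈-pointwise x≡y = ≤-antisym (≤-pointwise (always λ n → ℚ.≤-reflexive (x≡y n)))
                              (≤-pointwise (always λ n → ℚ.≤-reflexive (sym (x≡y n))))

  +-mono-≤ : ∀ {x y u v} → x ≤ y → u ≤ v → x + u ≤ y + v
  +-mono-≤ {x} {y} {u} {v} x≤y u≤v = mk≤ λ ε ε>0 →
    eventually-map₂ (λ n p q → lin< (ℚ.+-mono-< p q) (eq (seq x n) (seq y n) (seq u n) (seq v n) ε))
      (below x≤y _ (0<½* ε>0)) (below u≤v _ (0<½* ε>0))
    where
    eq : ∀ a b c d ε → (a ℚ.+ c) ℚ.+ ((b ℚ.+ ½ ℚ.* ε) ℚ.+ (d ℚ.+ ½ ℚ.* ε)) ≡ ((b ℚ.+ d) ℚ.+ ε) ℚ.+ (a ℚ.+ c)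
    eq = solve 5 (λ a b c d ε → (a :+ c) :+ ((b :+ con ½ :* ε) :+ (d :+ con ½ :* ε))
                                := ((b :+ d) :+ ε) :+ (a :+ c)) refl

  neg-antimono-≤ : ∀ {x y} → x ≤ y → - y ≤ - x
  neg-antimono-≤ {x} {y} x≤y = mk≤ λ ε ε>0 →
    eventually-map (λ n p → lin< p (eq (seq x n) (seq y n) ε)) (below x≤y ε ε>0)
    where
    eq : ∀ a b ε → ℚ.- b ℚ.+ (b ℚ.+ ε) ≡ (ℚ.- a ℚ.+ ε) ℚ.+ a
    eq = solve 3 (λ a b ε → :- b :+ (b :+ ε) := (:- a :+ ε) :+ a) refl

  neg-involutive : ∀ x → - (- x) ≈ x
  neg-involutive x = ≈-pointwise λ n → eq (seq x n)
    where
    eq : ∀ a → ℚ.- (ℚ.- a) ≡ a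
    eq = solve 1 (λ a → :- (:- a) := a) refl

  +-cong : ∀ {x y u v} → x ≈ y → u ≈ v → x + u ≈ y + v
  +-cong p q = ≤-antisym (+-mono-≤ (≈⇒≤ p) (≈⇒≤ q)) (+-mono-≤ (≈⇒≥ p) (≈⇒≥ q))

  neg-cong : ∀ {x y} → x ≈ y → - x ≈ - y
  neg-cong p = ≤-antisym (neg-antimono-≤ (≈⇒≥ p)) (neg-antimono-≤ (≈⇒≤ p))

  0*-cong : ∀ {x} y → x ≈ 0ℝ → x * y ≈ 0ℝ
  0*-cong {x} y x≈0 =
    let B , B>0 , y<B = eventually-bounded y
    in mk≈ λ ε ε>0 →
      let δ , δ>0 , Bδ≡ε = divide B>0 ε>0
      in eventually-map₂ (λ n p q → subst₂ ℚ._<_ (eq (seq x n) (seq y n)) Bδ≡ε (∣*∣< (seq y n) _ B>0 p q))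
           y<B (close x≈0 δ δ>0)
    where
    ring : ∀ a b → b ℚ.* (a ℚ.- 0ℚ) ≡ a ℚ.* b ℚ.- 0ℚ
    ring = solve 2 (λ a b → b :* (a :- con 0ℚ) := a :* b :- con 0ℚ) refl
    eq : ∀ a b → ℚ.∣ b ℚ.* (a ℚ.- 0ℚ) ∣ ≡ ℚ.∣ a ℚ.* b ℚ.- 0ℚ ∣
    eq a b = cong ℚ.∣_∣ (ring a b)

  ≈⇒-≈0 : ∀ {x y} → x ≈ y → x + - y ≈ 0ℝ
  ≈⇒-≈0 {x} {y} p = ≈-trans (+-cong p ≈-refl) (≈-pointwise λ n → ℚ.+-inverseʳ (seq y n))

  -≈0⇒≈ : ∀ {x y} → x + - y ≈ 0ℝ → x ≈ y
  -≈0⇒≈ {x} {y} p = ≈-trans (≈-pointwise λ n → eq (seq x n) (seq y n))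
    (≈-trans (+-cong p (≈-refl {y})) (≈-pointwise λ n → ℚ.+-identityˡ (seq y n)))
    where
    eq : ∀ a b → a ≡ (a ℚ.- b) ℚ.+ b
    eq = solve 2 (λ a b → a := (a :- b) :+ b) refl

  *-cong : ∀ {x y u v} → x ≈ y → u ≈ v → x * u ≈ y * v
  *-cong {x} {y} {u} {v} x≈y u≈v = -≈0⇒≈ (≈-trans
    (≈-pointwise λ n → eq (seq x n) (seq y n) (seq u n) (seq v n))
    (≈-trans (+-cong (0*-cong u (≈⇒-≈0 x≈y)) (0*-cong y (≈⇒-≈0 u≈v)))
             (≈-pointwise λ n → ℚ.+-identityˡ 0ℚ)))
    where
    eq : ∀ a b c d → a ℚ.* c ℚ.- b ℚ.* d ≡ (a ℚ.- b) ℚ.* c ℚ.+ (c ℚ.- d) ℚ.* b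
    eq = solve 4 (λ a b c d → a :* c :- b :* d := (a :- b) :* c :+ (c :- d) :* b) refl

  ℝ-commutativeRing : CommutativeRing 0ℓ 0ℓ
  ℝ-commutativeRing = record
    { Carrier = ℝ ; _≈_ = _≈_ ; _+_ = _+_ ; _*_ = _*_ ; -_ = -_ ; 0# = 0ℝ ; 1# = 1ℝ
    ; isCommutativeRing = record
      { isRing = record
        { +-isAbelianGroup = record
          { isGroup = record
            { isMonoid = record
              { isSemigroup = record
                { isMagma = record
                  { isEquivalence = record { refl = ≈-refl ; sym = ≈-sym ; trans = ≈-trans }
                  ; ∙-cong = +-cong }
                ; assoc = λ x y z → ≈-pointwise λ n → ℚ.+-assoc (seq x n) (seq y n) (seq z n) }
              ; identity = (λ x → ≈-pointwise λ n → ℚ.+-identityˡ (seq x n))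
                         , (λ x → ≈-pointwise λ n → ℚ.+-identityʳ (seq x n)) }
            ; inverse = (λ x → ≈-pointwise λ n → ℚ.+-inverseˡ (seq x n))
                      , (λ x → ≈-pointwise λ n → ℚ.+-inverseʳ (seq x n))
            ; ⁻¹-cong = neg-cong }
          ; comm = λ x y → ≈-pointwise λ n → ℚ.+-comm (seq x n) (seq y n) }
        ; *-cong = *-cong
        ; *-assoc = λ x y z → ≈-pointwise λ n → ℚ.*-assoc (seq x n) (seq y n) (seq z n)
        ; *-identity = (λ x → ≈-pointwise λ n → ℚ.*-identityˡ (seq x n))
                     , (λ x → ≈-pointwise λ n → ℚ.*-identityʳ (seq x n))
        ; distrib = (λ x y z → ≈-pointwise λ n → ℚ.*-distribˡ-+ (seq x n) (seq y n) (seq z n))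
                  , (λ x y z → ≈-pointwise λ n → ℚ.*-distribʳ-+ (seq x n) (seq y n) (seq z n)) }
      ; *-comm = λ x y → ≈-pointwise λ n → ℚ.*-comm (seq x n) (seq y n) } }

  -- At a given index each factor is nonnegative only up to a tolerance. Each tolerance is ε divided
  -- by a bound on the other factor.
  0≤-* : ∀ {x y} → 0ℝ ≤ x → 0ℝ ≤ y → 0ℝ ≤ x * y
  0≤-* {x} {y} 0≤x 0≤y =
    let A , A>0 , x<A = eventually-bounded x
        B , B>0 , y<B = eventually-bounded y
    in mk≤ λ ε ε>0 →
      let δ , δ>0 , Bδ≡ε = divide B>0 ε>0
          η , η>0 , Aη≡ε = divide A>0 ε>0
      in eventually-map₂ (λ n (|x|<A , |y|<B) (-δ<x , -η<y) →
             bound (seq x n) (seq y n) A>0 B>0 |x|<A |y|<B Aη≡ε Bδ≡ε -δ<x -η<y ε>0)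
           (eventually-map₂ (λ _ → _,_) x<A y<B)
           (eventually-map₂ (λ _ → _,_) (below 0≤x δ δ>0) (below 0≤y η η>0))
    where
    -- A negative factor is small in absolute value, hence so is the product.
    small-neg : ∀ {a δ} → 0ℚ ℚ.< a ℚ.+ δ → a ℚ.< 0ℚ → ℚ.∣ a ∣ ℚ.< δ
    small-neg {a} {δ} h a<0 = ∣∣<-intro
      (lin< (ℚ.+-mono-< (ℚ.+-mono-< a<0 a<0) h) (eq₁ a δ)) (lin< h (eq₂ a δ))
      where
      eq₁ : ∀ a δ → a ℚ.+ ((0ℚ ℚ.+ 0ℚ) ℚ.+ (a ℚ.+ δ)) ≡ δ ℚ.+ ((a ℚ.+ a) ℚ.+ 0ℚ)
      eq₁ = solve 2 (λ a δ → a :+ ((con 0ℚ :+ con 0ℚ) :+ (a :+ δ)) := δ :+ ((a :+ a) :+ con 0ℚ)) refl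
      eq₂ : ∀ a δ → ℚ.- a ℚ.+ (a ℚ.+ δ) ≡ δ ℚ.+ 0ℚ
      eq₂ = solve 2 (λ a δ → :- a :+ (a :+ δ) := δ :+ con 0ℚ) refl
    fromAbs : ∀ {p ε} → ℚ.∣ p ∣ ℚ.< ε → 0ℚ ℚ.< p ℚ.+ ε
    fromAbs {p} {ε} h = lin< (ℚ.≤-<-trans (-p≤∣p∣ p) h) (eq p ε)
      where
      eq : ∀ p ε → 0ℚ ℚ.+ ε ≡ (p ℚ.+ ε) ℚ.+ (ℚ.- p)
      eq = solve 2 (λ p ε → con 0ℚ :+ ε := (p :+ ε) :+ (:- p)) refl
    bound : ∀ {A B δ η ε} a b → 0ℚ ℚ.< A → 0ℚ ℚ.< B → ℚ.∣ a ∣ ℚ.< A → ℚ.∣ b ∣ ℚ.< B →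
            A ℚ.* η ≡ ε → B ℚ.* δ ≡ ε → 0ℚ ℚ.< a ℚ.+ δ → 0ℚ ℚ.< b ℚ.+ η → 0ℚ ℚ.< ε →
            0ℚ ℚ.< a ℚ.* b ℚ.+ ε
    bound {ε = ε} a b A>0 B>0 a<A b<B refl Bδ≡ε -δ<a -η<b ε>0 with ℚ.≤-total 0ℚ a | ℚ.≤-total 0ℚ b
    ... | inj₁ 0≤a | inj₁ 0≤b = ℚ.+-mono-≤-< (0≤* 0≤a 0≤b) ε>0
    ... | _ | inj₂ b≤0 with b ℚ.<? 0ℚ
    ...   | yes b<0 = fromAbs (∣*∣< a b A>0 a<A (small-neg -η<b b<0))
    ...   | no b≮0 = ℚ.+-mono-≤-< (ℚ.≤-reflexive (sym (trans (cong (a ℚ.*_) (ℚ.≤-antisym b≤0 (ℚ.≮⇒≥ b≮0))) (ℚ.*-zeroʳ a)))) ε>0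
    bound {ε = ε} a b A>0 B>0 a<A b<B refl Bδ≡ε -δ<a -η<b ε>0 | inj₂ a≤0 | inj₁ _ with a ℚ.<? 0ℚ
    ...   | yes a<0 = subst (λ c → 0ℚ ℚ.< c ℚ.+ ε) (ℚ.*-comm b a)
                        (fromAbs (subst (ℚ.∣ b ℚ.* a ∣ ℚ.<_) Bδ≡ε (∣*∣< b a B>0 b<B (small-neg -δ<a a<0))))
    ...   | no a≮0 = ℚ.+-mono-≤-< (ℚ.≤-reflexive (sym (trans (cong (ℚ._* b) (ℚ.≤-antisym a≤0 (ℚ.≮⇒≥ a≮0))) (ℚ.*-zeroˡ b)))) ε>0

  -- The rational bound is the data needed for division. Refuting `x ≤ 0ℝ` yields it only up to
  -- double negation.
  Positive : ℝ → Set
  Positive x = ∃[ q ] 0ℚ ℚ.< q × Eventually λ n → q ℚ.< seq x n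

  -- Beyond `N` the sequence varies by less than ε/2, so a single term of at least ε would keep the
  -- whole tail above ε/2.
  ¬Positive⇒≤0 : ∀ {x} → ¬ Positive x → x ≤ 0ℝ
  ¬Positive⇒≤0 {x} ¬pos = mk≤ λ ε ε>0 →
    let N , near = cauchy x (½ ℚ.* ε) (0<½* ε>0)
    in N , λ n N≤n → [ (λ ε≤xN → contradiction
                          (½ ℚ.* ε , 0<½* ε>0 , N , λ m N≤m →
                            lin< (ℚ.+-mono-≤-< ε≤xN (∣-∣<⇒< (near n m N≤n N≤m))) (eq ε (seq x n) (seq x m)))
                          ¬pos)
                     , (λ x<ε → subst (seq x n ℚ.<_) (sym (ℚ.+-identityˡ ε)) x<ε) ]′ (≤⊎> ε (seq x n))
    where
    ≤⊎> : ∀ p q → p ℚ.≤ q ⊎ q ℚ.< p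
    ≤⊎> p q with p ℚ.≤? q
    ... | yes p≤q = inj₁ p≤q
    ... | no p≰q = inj₂ (ℚ.≰⇒> p≰q)
    eq : ∀ ε a b → ½ ℚ.* ε ℚ.+ (a ℚ.+ (b ℚ.+ ½ ℚ.* ε)) ≡ b ℚ.+ (ε ℚ.+ a)
    eq = solve 3 (λ ε a b → con ½ :* ε :+ (a :+ (b :+ con ½ :* ε)) := b :+ (ε :+ a)) refl

  ¬Positive-0 : ¬ Positive 0ℝ
  ¬Positive-0 (q , q>0 , ev) = let _ , q<0 = eventually-inhabited ev in ℚ.<-asym q>0 q<0

  -- One rational comparison decides: past an index where `x` varies by less than q/4, either `x`
  -- has reached q/2 and stays above q/4, or it stays below 3q/4 and leaves more than q/4 to `y`.
  Positive-+ : ∀ x y → Positive (x + y) → Positive x ⊎ Positive y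
  Positive-+ x y (q , q>0 , ev) with cauchy x r r>0
    where
    r = ½ ℚ.* (½ ℚ.* q)
    r>0 = 0<½* (0<½* q>0)
  ... | N , near with ½ ℚ.* q ℚ.≤? seq x N
  ...   | yes h = inj₁ (r , 0<½* (0<½* q>0) , N , λ m N≤m →
                    lin< (ℚ.+-mono-≤-< h (∣-∣<⇒< (near N m ℕ.≤-refl N≤m))) (eq q (seq x N) (seq x m)))
    where
    r = ½ ℚ.* (½ ℚ.* q)
    eq : ∀ q a b → ½ ℚ.* (½ ℚ.* q) ℚ.+ (a ℚ.+ (b ℚ.+ ½ ℚ.* (½ ℚ.* q))) ≡ b ℚ.+ (½ ℚ.* q ℚ.+ a)
    eq = solve 3 (λ q a b → con ½ :* (con ½ :* q) :+ (a :+ (b :+ con ½ :* (con ½ :* q)))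
                            := b :+ (con ½ :* q :+ a)) refl
  ...   | no h = inj₂ (r , 0<½* (0<½* q>0) , eventually-map₂
                   (λ m q<x+y (xm : seq x m ℚ.< seq x N ℚ.+ r) → lin< (ℚ.+-mono-< q<x+y (ℚ.+-mono-< xm (ℚ.≰⇒> h)))
                                        (eq q (seq x N) (seq x m) (seq y m)))
                   ev (N , λ m N≤m → ∣-∣<⇒< {seq x m} {seq x N} (near m N N≤m ℕ.≤-refl)))
    where
    r = ½ ℚ.* (½ ℚ.* q)
    eq : ∀ q a b c → ½ ℚ.* (½ ℚ.* q) ℚ.+ ((b ℚ.+ c) ℚ.+ ((a ℚ.+ ½ ℚ.* (½ ℚ.* q)) ℚ.+ ½ ℚ.* q))
                     ≡ c ℚ.+ (q ℚ.+ (b ℚ.+ a))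
    eq = solve 4 (λ q a b c → con ½ :* (con ½ :* q) :+ ((b :+ c) :+ ((a :+ con ½ :* (con ½ :* q)) :+ con ½ :* q))
                     := c :+ (q :+ (b :+ a))) refl

  Positive-*≈0 : ∀ {x y} → Positive x → x * y ≈ 0ℝ → y ≈ 0ℝ
  Positive-*≈0 {x} {y} (q , q>0 , q<x) xy≈0 = mk≈ λ ε ε>0 →
    eventually-map₂ (λ n q<xn xy<qε → step (seq x n) (seq y n) ε q<xn xy<qε) q<x (close xy≈0 (q ℚ.* ε) (0<* q>0 ε>0))
    where
    step : ∀ a b ε → q ℚ.< a → ℚ.∣ a ℚ.* b ℚ.- 0ℚ ∣ ℚ.< q ℚ.* ε → ℚ.∣ b ℚ.- 0ℚ ∣ ℚ.< ε
    step a b ε q<a ab<qε = subst (ℚ._< ε) (cong ℚ.∣_∣ (sym (ℚ.+-identityʳ b)))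
      (ℚ.*-cancelˡ-<-nonNeg q {{ℚ.nonNegative (ℚ.<⇒≤ q>0)}} (begin-strict
        q ℚ.* ℚ.∣ b ∣           ≤⟨ ℚ.*-monoʳ-≤-nonNeg ℚ.∣ b ∣ {{ℚ.∣-∣-nonNeg b}} (ℚ.<⇒≤ (ℚ.<-≤-trans q<a (p≤∣p∣ a))) ⟩
        ℚ.∣ a ∣ ℚ.* ℚ.∣ b ∣     ≡⟨ ℚ.∣p*q∣≡∣p∣*∣q∣ a b ⟨
        ℚ.∣ a ℚ.* b ∣           ≡⟨ cong ℚ.∣_∣ (ℚ.+-identityʳ (a ℚ.* b)) ⟨
        ℚ.∣ a ℚ.* b ℚ.- 0ℚ ∣    <⟨ ab<qε ⟩
        q ℚ.* ε                 ∎))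
      where open ℚ.≤-Reasoning

  -- Packing in rational space

  ι : ℕ → ℚ
  ι zero    = 0ℚ
  ι (suc n) = 1ℚ ℚ.+ ι n

  ι-+ : ∀ m n → ι (m ℕ.+ n) ≡ ι m ℚ.+ ι n
  ι-+ zero    n = sym (ℚ.+-identityˡ (ι n))
  ι-+ (suc m) n = trans (cong (1ℚ ℚ.+_) (ι-+ m n)) (sym (ℚ.+-assoc 1ℚ (ι m) (ι n)))

  ι-* : ∀ m n → ι (m ℕ.* n) ≡ ι m ℚ.* ι n
  ι-* zero    n = sym (ℚ.*-zeroˡ (ι n))
  ι-* (suc m) n = trans (ι-+ n (m ℕ.* n)) (trans (cong (ι n ℚ.+_) (ι-* m n)) (eq (ι m) (ι n)))
    where
    eq : ∀ a b → b ℚ.+ a ℚ.* b ≡ (1ℚ ℚ.+ a) ℚ.* b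
    eq = solve 2 (λ a b → b :+ a :* b := (con 1ℚ :+ a) :* b) refl

  ι-2^suc : ∀ k → ι (2 ^ suc k) ≡ ι (2 ^ k) ℚ.+ ι (2 ^ k)
  ι-2^suc k = trans (cong (λ n → ι (2 ^ k ℕ.+ n)) (ℕ.+-identityʳ (2 ^ k))) (ι-+ (2 ^ k) (2 ^ k))

  0≤ι : ∀ n → 0ℚ ℚ.≤ ι n
  0≤ι zero    = ℚ.≤-refl
  0≤ι (suc n) = ℚ.+-mono-≤ (ℚ.<⇒≤ 0<1ℚ) (0≤ι n)

  0<ι : ∀ n .{{_ : NonZero n}} → 0ℚ ℚ.< ι n
  0<ι (suc n) = ℚ.+-mono-<-≤ 0<1ℚ (0≤ι n)

  ι-mono-≤ : ∀ {m n} → m ℕ.≤ n → ι m ℚ.≤ ι n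
  ι-mono-≤ {n = n} z≤n       = 0≤ι n
  ι-mono-≤ (s≤s m≤n) = ℚ.+-monoʳ-≤ 1ℚ (ι-mono-≤ m≤n)

  -- The integer part, found by repeated subtraction. Closed cells suffice: all that matters is that
  -- two points of one cell differ by at most 1.
  cell : ∀ G q → 0ℚ ℚ.≤ q → q ℚ.< ι G → Σ[ z ∈ Fin G ] ι (toℕ z) ℚ.≤ q × q ℚ.≤ 1ℚ ℚ.+ ι (toℕ z)
  cell zero    q 0≤q q<0 = contradiction (ℚ.≤-<-trans 0≤q q<0) (ℚ.<-irrefl refl)
  cell (suc G) q 0≤q q<G with q ℚ.≤? 1ℚ
  ... | yes q≤1 = zero , 0≤q , q≤1
  ... | no q≰1 =
    let z , z≤q-1 , q-1≤z+1 = cell G (q ℚ.- 1ℚ) (lin≤ (ℚ.<⇒≤ (ℚ.≰⇒> q≰1)) (eq₁ q)) (lin< q<G (eq₂ q (ι G)))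
    in suc z , lin≤ z≤q-1 (eq₃ q (ι (toℕ z))) , lin≤ q-1≤z+1 (eq₄ q (ι (toℕ z)))
    where
    eq₁ : ∀ q → 0ℚ ℚ.+ q ≡ (q ℚ.- 1ℚ) ℚ.+ 1ℚ
    eq₁ = solve 1 (λ q → con 0ℚ :+ q := (q :- con 1ℚ) :+ con 1ℚ) refl
    eq₂ : ∀ q g → (q ℚ.- 1ℚ) ℚ.+ (1ℚ ℚ.+ g) ≡ g ℚ.+ q
    eq₂ = solve 2 (λ q g → (q :- con 1ℚ) :+ (con 1ℚ :+ g) := g :+ q) refl
    eq₃ : ∀ q z → (1ℚ ℚ.+ z) ℚ.+ (q ℚ.- 1ℚ) ≡ q ℚ.+ z
    eq₃ = solve 2 (λ q z → (con 1ℚ :+ z) :+ (q :- con 1ℚ) := q :+ z) refl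
    eq₄ : ∀ q z → q ℚ.+ (1ℚ ℚ.+ z) ≡ (1ℚ ℚ.+ (1ℚ ℚ.+ z)) ℚ.+ (q ℚ.- 1ℚ)
    eq₄ = solve 2 (λ q z → q :+ (con 1ℚ :+ z) := (con 1ℚ :+ (con 1ℚ :+ z)) :+ (q :- con 1ℚ)) refl

  sumℚ-mono-≤ : ∀ {n} {f g : Vector ℚ n} → (∀ i → f i ℚ.≤ g i) → sumℚ f ℚ.≤ sumℚ g
  sumℚ-mono-≤ {zero}  f≤g = ℚ.≤-refl
  sumℚ-mono-≤ {suc n} f≤g = ℚ.+-mono-≤ (f≤g zero) (sumℚ-mono-≤ λ i → f≤g (suc i))

  dot : ∀ {d} → Vector ℚ d → Vector ℚ d → ℚ
  dot a x = sumℚ λ j → a j ℚ.* x j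

  dot-axpy : ∀ {d} (a x : Vector ℚ d) c y → dot a (λ j → x j ℚ.+ c ℚ.* y j) ≡ dot a x ℚ.+ c ℚ.* dot a y
  dot-axpy a x c y = begin
    dot a (λ j → x j ℚ.+ c ℚ.* y j)
      ≡⟨ sumℚ-cong (λ j → eq (a j) (x j) c (y j)) ⟩
    sumℚ (λ j → a j ℚ.* x j ℚ.+ c ℚ.* (a j ℚ.* y j))
      ≡⟨ sumℚ-+ (λ j → a j ℚ.* x j) (λ j → c ℚ.* (a j ℚ.* y j)) ⟩
    dot a x ℚ.+ sumℚ (λ j → c ℚ.* (a j ℚ.* y j))
      ≡⟨ cong (dot a x ℚ.+_) (*-distribˡ-sumℚ c (λ j → a j ℚ.* y j)) ⟨
    dot a x ℚ.+ c ℚ.* dot a y ∎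
    where
    open ≡-Reasoning
    eq : ∀ a x c y → a ℚ.* (x ℚ.+ c ℚ.* y) ≡ a ℚ.* x ℚ.+ c ℚ.* (a ℚ.* y)
    eq = solve 4 (λ a x c y → a :* (x :+ c :* y) := a :* x :+ c :* (a :* y)) refl

  2ℚ : ℚ
  2ℚ = 1ℚ ℚ.+ 1ℚ

  -- Σₜ 2ᵗ v(sₜ), where s₀, s₁, … are the base-N digits of the index, leading digit first.
  binaryCombination : ∀ {N d} → Vector (Vector ℚ d) N → ∀ k → Fin (N ^ k) → Vector ℚ d
  binaryCombination         v zero    s j = 0ℚ
  binaryCombination {N} {d} v (suc k) s j =
    v (proj₁ (remQuot {N} (N ^ k) s)) j ℚ.+ 2ℚ ℚ.* binaryCombination v k (proj₂ (remQuot {N} (N ^ k) s)) j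

  -- A separating functional rescaled to offset 1, with tolerance η. `L` bounds its ℓ¹ norm, hence
  -- its Lipschitz constant for the maximum norm.
  record NearlySeparating {N d} (v : Vector (Vector ℚ d) N) (L η : ℚ) (x y : Fin N) : Set where
    field
      normal : Vector ℚ d
      upper  : ∀ l → dot normal (v l) ℚ.≤ 1ℚ ℚ.+ η
      lower  : ∀ l → ℚ.- dot normal (v l) ℚ.≤ 1ℚ ℚ.+ η
      high   : 1ℚ ℚ.- η ℚ.≤ dot normal (v x)
      low    : 1ℚ ℚ.- η ℚ.≤ ℚ.- dot normal (v y)
      small  : sumℚ (λ j → ℚ.∣ normal j ∣) ℚ.≤ L

  -- Prepending digits turns a gap g into at least 2g - 2(1 + η). The value 2 + 2η is the fixed
  -- point of this map, so only the error coefficient `e` doubles.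
  gap-scale : ∀ η vs vt ps pt e → 2ℚ ℚ.+ 2ℚ ℚ.* η ℚ.≤ (ps ℚ.- pt) ℚ.+ e ℚ.* η →
    ℚ.- vs ℚ.≤ 1ℚ ℚ.+ η → vt ℚ.≤ 1ℚ ℚ.+ η →
    2ℚ ℚ.+ 2ℚ ℚ.* η ℚ.≤ ((vs ℚ.+ 2ℚ ℚ.* ps) ℚ.- (vt ℚ.+ 2ℚ ℚ.* pt)) ℚ.+ (e ℚ.+ e) ℚ.* η
  gap-scale η vs vt ps pt e gap lower upper =
    lin≤ (ℚ.+-mono-≤ (ℚ.+-mono-≤ gap gap) (ℚ.+-mono-≤ lower upper)) (eq η vs vt ps pt e)
    where
    eq : ∀ η vs vt ps pt e →
      (2ℚ ℚ.+ 2ℚ ℚ.* η) ℚ.+ (((ps ℚ.- pt ℚ.+ e ℚ.* η) ℚ.+ (ps ℚ.- pt ℚ.+ e ℚ.* η)) ℚ.+ ((1ℚ ℚ.+ η) ℚ.+ (1ℚ ℚ.+ η))) ≡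
      ((vs ℚ.+ 2ℚ ℚ.* ps) ℚ.- (vt ℚ.+ 2ℚ ℚ.* pt)) ℚ.+ (e ℚ.+ e) ℚ.* η ℚ.+
        ((2ℚ ℚ.+ 2ℚ ℚ.* η ℚ.+ (2ℚ ℚ.+ 2ℚ ℚ.* η)) ℚ.+ (ℚ.- vs ℚ.+ vt))
    eq = solve 6 (λ η vs vt ps pt e →
      (con 2ℚ :+ con 2ℚ :* η) :+ (((ps :- pt :+ e :* η) :+ (ps :- pt :+ e :* η)) :+ ((con 1ℚ :+ η) :+ (con 1ℚ :+ η))) :=
      ((vs :+ con 2ℚ :* ps) :- (vt :+ con 2ℚ :* pt)) :+ (e :+ e) :* η :+
        ((con 2ℚ :+ con 2ℚ :* η :+ (con 2ℚ :+ con 2ℚ :* η)) :+ (:- vs :+ vt))) refl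

  -- Equal tails cancel and the heads contribute 2 - 2η. The missing 4η is paid by the error term,
  -- whose coefficient 4e is at least 4.
  gap-start : ∀ η vs vt p e → 0ℚ ℚ.≤ η → 1ℚ ℚ.≤ e → 1ℚ ℚ.- η ℚ.≤ vs → 1ℚ ℚ.- η ℚ.≤ ℚ.- vt →
    2ℚ ℚ.+ 2ℚ ℚ.* η ℚ.≤ ((vs ℚ.+ 2ℚ ℚ.* p) ℚ.- (vt ℚ.+ 2ℚ ℚ.* p)) ℚ.+ ((e ℚ.+ e) ℚ.+ (e ℚ.+ e)) ℚ.* η
  gap-start η vs vt p e 0≤η 1≤e high low =
    lin≤ (ℚ.+-mono-≤ (ℚ.+-mono-≤ high low) (ℚ.+-mono-≤ (ℚ.+-mono-≤ η≤ η≤) (ℚ.+-mono-≤ η≤ η≤))) (eq η vs vt p e)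
    where
    η≤ : η ℚ.≤ e ℚ.* η
    η≤ = subst (ℚ._≤ e ℚ.* η) (ℚ.*-identityˡ η) (ℚ.*-monoʳ-≤-nonNeg η {{ℚ.nonNegative 0≤η}} 1≤e)
    eq : ∀ η vs vt p e →
      (2ℚ ℚ.+ 2ℚ ℚ.* η) ℚ.+ ((vs ℚ.+ ℚ.- vt) ℚ.+ ((e ℚ.* η ℚ.+ e ℚ.* η) ℚ.+ (e ℚ.* η ℚ.+ e ℚ.* η))) ≡
      ((vs ℚ.+ 2ℚ ℚ.* p) ℚ.- (vt ℚ.+ 2ℚ ℚ.* p)) ℚ.+ ((e ℚ.+ e) ℚ.+ (e ℚ.+ e)) ℚ.* η ℚ.+
        (((1ℚ ℚ.- η) ℚ.+ (1ℚ ℚ.- η)) ℚ.+ ((η ℚ.+ η) ℚ.+ (η ℚ.+ η)))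
    eq = solve 5 (λ η vs vt p e →
      (con 2ℚ :+ con 2ℚ :* η) :+ ((vs :+ :- vt) :+ ((e :* η :+ e :* η) :+ (e :* η :+ e :* η))) :=
      ((vs :+ con 2ℚ :* p) :- (vt :+ con 2ℚ :* p)) :+ ((e :+ e) :+ (e :+ e)) :* η :+
        (((con 1ℚ :- η) :+ (con 1ℚ :- η)) :+ ((η :+ η) :+ (η :+ η)))) refl

  module _ {N d} (v : Vector (Vector ℚ d) N) {L η : ℚ} (0≤η : 0ℚ ℚ.≤ η)
           (sep : ∀ x y → x ≢ y → NearlySeparating v L η x y) where

    open NearlySeparating

    -- The pair `x`, `y` is left open: it turns out to be the digits of `s` and `t` at the highest
    -- place where they differ. The multiple of η is the accumulated error.
    Separated : ∀ k → (s t : Fin (N ^ k)) → Set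
    Separated k s t = ∃[ x ] ∃[ y ] Σ[ S ∈ NearlySeparating v L η x y ]
      2ℚ ℚ.+ 2ℚ ℚ.* η ℚ.≤ (dot (normal S) (binaryCombination v k s) ℚ.- dot (normal S) (binaryCombination v k t))
                           ℚ.+ ι (2 ^ suc k) ℚ.* η

    -- The packing argument: distinct translates of the polytope by the vertices
    -- have disjoint interiors, hence so have those by binary combinations.
    combinations-separated : ∀ k s t → s ≢ t → Separated k s t
    combinations-separated zero    zero zero s≢t = contradiction refl s≢t
    combinations-separated (suc k) s    t    s≢t = go (tail s Fin.≟ tail t)
      where
      head = λ s → proj₁ (remQuot {N} (N ^ k) s)
      tail = λ s → proj₂ (remQuot {N} (N ^ k) s)
      p    = λ s → binaryCombination v k (tail s)

      expand : ∀ a {e} → ι (2 ^ suc (suc k)) ≡ e →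
        2ℚ ℚ.+ 2ℚ ℚ.* η ℚ.≤ ((dot a (v (head s)) ℚ.+ 2ℚ ℚ.* dot a (p s)) ℚ.- (dot a (v (head t)) ℚ.+ 2ℚ ℚ.* dot a (p t)))
                             ℚ.+ e ℚ.* η →
        2ℚ ℚ.+ 2ℚ ℚ.* η ℚ.≤ (dot a (binaryCombination v (suc k) s) ℚ.- dot a (binaryCombination v (suc k) t))
                             ℚ.+ ι (2 ^ suc (suc k)) ℚ.* η
      expand a e≡ = subst₂ (λ D E → 2ℚ ℚ.+ 2ℚ ℚ.* η ℚ.≤ D ℚ.+ E ℚ.* η)
        (sym (cong₂ ℚ._-_ (dot-axpy a (v (head s)) 2ℚ (p s)) (dot-axpy a (v (head t)) 2ℚ (p t)))) (sym e≡)

      go : Dec (tail s ≡ tail t) → Separated (suc k) s t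
      go (no tails≢) =
        let x , y , S , gap = combinations-separated k (tail s) (tail t) tails≢
        in x , y , S , expand (normal S) (ι-2^suc (suc k))
             (gap-scale η (dot (normal S) (v (head s))) (dot (normal S) (v (head t)))
               (dot (normal S) (p s)) (dot (normal S) (p t)) (ι (2 ^ suc k)) gap (lower S (head s)) (upper S (head t)))
      go (yes tails≡) =
        let S = sep (head s) (head t) λ heads≡ → s≢t (trans (sym (Fin.combine-remQuot {N} (N ^ k) s))
                  (trans (cong₂ combine heads≡ tails≡) (Fin.combine-remQuot {N} (N ^ k) t)))
            a = normal S
        in head s , head t , S , expand a (trans (ι-2^suc (suc k)) (cong₂ ℚ._+_ (ι-2^suc k) (ι-2^suc k)))
             (subst (λ u → 2ℚ ℚ.+ 2ℚ ℚ.* η ℚ.≤ ((dot a (v (head s)) ℚ.+ 2ℚ ℚ.* dot a (p s)) ℚ.-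
                                                 (dot a (v (head t)) ℚ.+ 2ℚ ℚ.* dot a (binaryCombination v k u)))
                                                ℚ.+ ((ι (2 ^ k) ℚ.+ ι (2 ^ k)) ℚ.+ (ι (2 ^ k) ℚ.+ ι (2 ^ k))) ℚ.* η)
                tails≡ (gap-start η (dot a (v (head s))) (dot a (v (head t))) (dot a (p s)) (ι (2 ^ k)) 0≤η (ι-mono-≤ (ℕ.m^n>0 2 k)) (high S) (low S)))

  -- The weights 1, 2, 4, ... add up to 2ᵏ - 1. Writing the missing `M` on the left avoids
  -- subtraction, and it is the slack that makes the bound strict in `packing-bound`.
  ∣binaryCombination∣ : ∀ {N d M} (v : Vector (Vector ℚ d) N) → (∀ l j → ℚ.∣ v l j ∣ ℚ.≤ M) →
    ∀ k s j → ℚ.∣ binaryCombination v k s j ∣ ℚ.+ M ℚ.≤ ι (2 ^ k) ℚ.* M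
  ∣binaryCombination∣ {M = M} v v≤M zero s j = ℚ.≤-reflexive (eq M)
    where
    eq : ∀ M → 0ℚ ℚ.+ M ≡ (1ℚ ℚ.+ 0ℚ) ℚ.* M
    eq = solve 1 (λ M → con 0ℚ :+ M := (con 1ℚ :+ con 0ℚ) :* M) refl
  ∣binaryCombination∣ {N} {M = M} v v≤M (suc k) s j = begin
    ℚ.∣ v x j ℚ.+ 2ℚ ℚ.* p ∣ ℚ.+ M              ≤⟨ ℚ.+-monoˡ-≤ M (ℚ.∣p+q∣≤∣p∣+∣q∣ (v x j) (2ℚ ℚ.* p)) ⟩
    (ℚ.∣ v x j ∣ ℚ.+ ℚ.∣ 2ℚ ℚ.* p ∣) ℚ.+ M      ≡⟨ cong (λ c → (ℚ.∣ v x j ∣ ℚ.+ c) ℚ.+ M) (ℚ.∣p*q∣≡∣p∣*∣q∣ 2ℚ p) ⟩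
    (ℚ.∣ v x j ∣ ℚ.+ 2ℚ ℚ.* ℚ.∣ p ∣) ℚ.+ M      ≤⟨ lin≤ (ℚ.+-mono-≤ (v≤M x j) (ℚ.+-mono-≤ ih ih)) (eq ℚ.∣ v x j ∣ ℚ.∣ p ∣ M (ι (2 ^ k))) ⟩
    (ι (2 ^ k) ℚ.+ ι (2 ^ k)) ℚ.* M             ≡⟨ cong (ℚ._* M) (ι-2^suc k) ⟨
    ι (2 ^ suc k) ℚ.* M                         ∎
    where
    open ℚ.≤-Reasoning
    x = proj₁ (remQuot {N} (N ^ k) s)
    p = binaryCombination v k (proj₂ (remQuot {N} (N ^ k) s)) j
    ih = ∣binaryCombination∣ v v≤M k (proj₂ (remQuot {N} (N ^ k) s)) j
    eq : ∀ a p M e → ((a ℚ.+ 2ℚ ℚ.* p) ℚ.+ M) ℚ.+ (M ℚ.+ (e ℚ.* M ℚ.+ e ℚ.* M)) ≡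
                     (e ℚ.+ e) ℚ.* M ℚ.+ (a ℚ.+ ((p ℚ.+ M) ℚ.+ (p ℚ.+ M)))
    eq = solve 4 (λ a p M e → ((a :+ con 2ℚ :* p) :+ M) :+ (M :+ (e :* M :+ e :* M)) :=
                     (e :+ e) :* M :+ (a :+ ((p :+ M) :+ (p :+ M)))) refl

  -- Hölder's inequality for the ℓ¹ and maximum norms, multiplied by `L` so that nothing is divided.
  dot-close : ∀ {d} (a p q : Vector ℚ d) L → 0ℚ ℚ.< L → sumℚ (λ j → ℚ.∣ a j ∣) ℚ.≤ L →
    (∀ j → ℚ.∣ L ℚ.* (p j ℚ.- q j) ∣ ℚ.≤ 1ℚ) → dot a p ℚ.- dot a q ℚ.≤ 1ℚ
  dot-close a p q L 0<L a≤L close = ℚ.*-cancelˡ-≤-pos L {{ℚ.positive 0<L}} (begin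
    L ℚ.* (dot a p ℚ.- dot a q)
      ≡⟨ cong (L ℚ.*_) (cong (dot a p ℚ.+_) (eq₁ (dot a q))) ⟩
    L ℚ.* (dot a p ℚ.+ ℚ.- 1ℚ ℚ.* dot a q)
      ≡⟨ cong (L ℚ.*_) (dot-axpy a p (ℚ.- 1ℚ) q) ⟨
    L ℚ.* dot a (λ j → p j ℚ.+ ℚ.- 1ℚ ℚ.* q j)
      ≡⟨ *-distribˡ-sumℚ L (λ j → a j ℚ.* (p j ℚ.+ ℚ.- 1ℚ ℚ.* q j)) ⟩
    sumℚ (λ j → L ℚ.* (a j ℚ.* (p j ℚ.+ ℚ.- 1ℚ ℚ.* q j)))
      ≤⟨ sumℚ-mono-≤ (λ j → bound j) ⟩
    sumℚ (λ j → ℚ.∣ a j ∣)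
      ≤⟨ a≤L ⟩
    L
      ≡⟨ ℚ.*-identityʳ L ⟨
    L ℚ.* 1ℚ ∎)
    where
    open ℚ.≤-Reasoning
    eq₁ : ∀ x → ℚ.- x ≡ ℚ.- 1ℚ ℚ.* x
    eq₁ = solve 1 (λ x → :- x := :- con 1ℚ :* x) refl
    eq₂ : ∀ L a p q → L ℚ.* (a ℚ.* (p ℚ.+ ℚ.- 1ℚ ℚ.* q)) ≡ a ℚ.* (L ℚ.* (p ℚ.- q))
    eq₂ = solve 4 (λ L a p q → L :* (a :* (p :+ :- con 1ℚ :* q)) := a :* (L :* (p :- q))) refl
    bound : ∀ j → L ℚ.* (a j ℚ.* (p j ℚ.+ ℚ.- 1ℚ ℚ.* q j)) ℚ.≤ ℚ.∣ a j ∣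
    bound j = begin
      L ℚ.* (a j ℚ.* (p j ℚ.+ ℚ.- 1ℚ ℚ.* q j))   ≡⟨ eq₂ L (a j) (p j) (q j) ⟩
      a j ℚ.* (L ℚ.* (p j ℚ.- q j))              ≤⟨ p≤∣p∣ _ ⟩
      ℚ.∣ a j ℚ.* (L ℚ.* (p j ℚ.- q j)) ∣        ≡⟨ ℚ.∣p*q∣≡∣p∣*∣q∣ (a j) _ ⟩
      ℚ.∣ a j ∣ ℚ.* ℚ.∣ L ℚ.* (p j ℚ.- q j) ∣    ≤⟨ ℚ.*-monoˡ-≤-nonNeg ℚ.∣ a j ∣ {{ℚ.∣-∣-nonNeg (a j)}} (close j) ⟩
      ℚ.∣ a j ∣ ℚ.* 1ℚ                           ≡⟨ ℚ.*-identityʳ ℚ.∣ a j ∣ ⟩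
      ℚ.∣ a j ∣                                  ∎

  same-cell⇒close : ∀ L p q R z → z ℚ.≤ L ℚ.* (p ℚ.+ R) → L ℚ.* (p ℚ.+ R) ℚ.≤ 1ℚ ℚ.+ z →
    z ℚ.≤ L ℚ.* (q ℚ.+ R) → L ℚ.* (q ℚ.+ R) ℚ.≤ 1ℚ ℚ.+ z → ℚ.∣ L ℚ.* (p ℚ.- q) ∣ ℚ.≤ 1ℚ
  same-cell⇒close L p q R z z≤p p≤z+1 z≤q q≤z+1 = ∣∣≤-intro
    (lin≤ (ℚ.+-mono-≤ p≤z+1 z≤q) (eq₁ L p q R z)) (lin≤ (ℚ.+-mono-≤ q≤z+1 z≤p) (eq₂ L p q R z))
    where
    eq₁ : ∀ L p q R z → L ℚ.* (p ℚ.- q) ℚ.+ ((1ℚ ℚ.+ z) ℚ.+ L ℚ.* (q ℚ.+ R)) ≡ 1ℚ ℚ.+ (L ℚ.* (p ℚ.+ R) ℚ.+ z)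
    eq₁ = solve 5 (λ L p q R z → L :* (p :- q) :+ ((con 1ℚ :+ z) :+ L :* (q :+ R)) := con 1ℚ :+ (L :* (p :+ R) :+ z)) refl
    eq₂ : ∀ L p q R z → ℚ.- (L ℚ.* (p ℚ.- q)) ℚ.+ ((1ℚ ℚ.+ z) ℚ.+ L ℚ.* (p ℚ.+ R)) ≡ 1ℚ ℚ.+ (L ℚ.* (q ℚ.+ R) ℚ.+ z)
    eq₂ = solve 5 (λ L p q R z → :- (L :* (p :- q)) :+ ((con 1ℚ :+ z) :+ L :* (p :+ R)) := con 1ℚ :+ (L :* (q :+ R) :+ z)) refl

  -- Points of one cell give D ≤ 1 and the total error is at most 1. Their sum 2 misses the required
  -- gap by the positive amount 2η, which is why the gap carries that surplus.
  gap-contradiction : ∀ η D e → 0ℚ ℚ.< η → D ℚ.≤ 1ℚ → e ℚ.≤ 1ℚ → ¬ (2ℚ ℚ.+ 2ℚ ℚ.* η ℚ.≤ D ℚ.+ e)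
  gap-contradiction η D e 0<η D≤1 e≤1 gap = ℚ.<-irrefl {0ℚ} refl
    (lin< (ℚ.+-mono-<-≤ (ℚ.+-mono-< 0<η 0<η) (ℚ.+-mono-≤ gap (ℚ.+-mono-≤ D≤1 e≤1))) (eq η D e))
    where
    eq : ∀ η D e → 0ℚ ℚ.+ ((η ℚ.+ η) ℚ.+ ((D ℚ.+ e) ℚ.+ (1ℚ ℚ.+ 1ℚ))) ≡
                   0ℚ ℚ.+ ((0ℚ ℚ.+ 0ℚ) ℚ.+ ((2ℚ ℚ.+ 2ℚ ℚ.* η) ℚ.+ (D ℚ.+ e)))
    eq = solve 3 (λ η D e → con 0ℚ :+ ((η :+ η) :+ ((D :+ e) :+ (con 1ℚ :+ con 1ℚ))) :=
                   con 0ℚ :+ ((con 0ℚ :+ con 0ℚ) :+ ((con 2ℚ :+ con 2ℚ :* η) :+ (D :+ e)))) refl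

  shifted-cell : ∀ G L R p → 0ℚ ℚ.< L → L ℚ.* (R ℚ.+ R) ≡ ι G → ℚ.∣ p ∣ ℚ.< R →
    Σ[ z ∈ Fin G ] ι (toℕ z) ℚ.≤ L ℚ.* (p ℚ.+ R) × L ℚ.* (p ℚ.+ R) ℚ.≤ 1ℚ ℚ.+ ι (toℕ z)
  shifted-cell G L R p 0<L size ∣p∣<R = cell G (L ℚ.* (p ℚ.+ R))
    (0≤* (ℚ.<⇒≤ 0<L) (lin≤ (ℚ.≤-trans (-p≤∣p∣ p) (ℚ.<⇒≤ ∣p∣<R)) (eq p R)))
    (subst (L ℚ.* (p ℚ.+ R) ℚ.<_) size
      (ℚ.*-monoʳ-<-pos L {{ℚ.positive 0<L}} (ℚ.+-monoˡ-< R (ℚ.≤-<-trans (p≤∣p∣ p) ∣p∣<R))))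
    where
    eq : ∀ p R → 0ℚ ℚ.+ R ≡ (p ℚ.+ R) ℚ.+ (ℚ.- p)
    eq = solve 2 (λ p R → con 0ℚ :+ R := (p :+ R) :+ (:- p)) refl

  -- The combinations lie in a box of half-side 2ᵏM. Cut into cells of side 1/L, it has L · 2ᵏ⁺¹M
  -- cells along each axis. Two combinations in one cell would differ by at most 1 under every
  -- functional of ℓ¹ norm at most L, contradicting their separation.
  packing-bound : ∀ {N d} (v : Vector (Vector ℚ d) N) L M .{{_ : NonZero L}} .{{_ : NonZero M}} k {η} →
    0ℚ ℚ.< η → ι (2 ^ suc k) ℚ.* η ℚ.≤ 1ℚ → (∀ l j → ℚ.∣ v l j ∣ ℚ.≤ ι M) →
    (∀ x y → x ≢ y → NearlySeparating v (ι L) η x y) →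
    N ^ k ℕ.≤ (L ℕ.* (2 ^ suc k ℕ.* M)) ^ d
  packing-bound {N} {d} v L M k {η} 0<η 2ᵏη≤1 v≤M sep = ℕ.≮⇒≥ λ lt →
    let s , t , s<t , same = Fin.pigeonhole lt (λ s → funToFin (box s))
    in collision s t (λ s≡t → Fin.<-irrefl s≡t s<t)
         λ j → trans (sym (Fin.finToFun-funToFin (box s) j))
                 (trans (cong (λ c → finToFun c j) same) (Fin.finToFun-funToFin (box t) j))
    where
    R = ι (2 ^ k) ℚ.* ι M
    p = binaryCombination v k

    size : ι L ℚ.* (R ℚ.+ R) ≡ ι (L ℕ.* (2 ^ suc k ℕ.* M))
    size = sym (trans (ι-* L (2 ^ suc k ℕ.* M)) (cong (ι L ℚ.*_) (trans (ι-* (2 ^ suc k) M)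
      (trans (cong (ℚ._* ι M) (ι-2^suc k)) (ℚ.*-distribʳ-+ (ι M) (ι (2 ^ k)) (ι (2 ^ k)))))))

    ∣p∣<R : ∀ s j → ℚ.∣ p s j ∣ ℚ.< R
    ∣p∣<R s j = lin< (ℚ.+-mono-≤-< (∣binaryCombination∣ v v≤M k s j) (0<ι M)) (eq ℚ.∣ p s j ∣ (ι M) R)
      where
      eq : ∀ p M R → p ℚ.+ (R ℚ.+ M) ≡ R ℚ.+ ((p ℚ.+ M) ℚ.+ 0ℚ)
      eq = solve 3 (λ p M R → p :+ (R :+ M) := R :+ ((p :+ M) :+ con 0ℚ)) refl

    boxCell : ∀ s j → Σ[ z ∈ Fin (L ℕ.* (2 ^ suc k ℕ.* M)) ]
      ι (toℕ z) ℚ.≤ ι L ℚ.* (p s j ℚ.+ R) × ι L ℚ.* (p s j ℚ.+ R) ℚ.≤ 1ℚ ℚ.+ ι (toℕ z)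
    boxCell s j = shifted-cell (L ℕ.* (2 ^ suc k ℕ.* M)) (ι L) R (p s j) (0<ι L) size (∣p∣<R s j)

    box : Fin (N ^ k) → Fin d → Fin (L ℕ.* (2 ^ suc k ℕ.* M))
    box s j = proj₁ (boxCell s j)

    collision : ∀ s t → s ≢ t → ¬ (∀ j → box s j ≡ box t j)
    collision s t s≢t same =
      let _ , _ , S , gap = combinations-separated v (ℚ.<⇒≤ 0<η) sep k s t s≢t
          a = NearlySeparating.normal S
      in gap-contradiction η (dot a (p s) ℚ.- dot a (p t)) (ι (2 ^ suc k) ℚ.* η) 0<η
           (dot-close a (p s) (p t) (ι L) (0<ι L) (NearlySeparating.small S) λ j →
              let z≡ = cong (λ z → ι (toℕ z)) (same j)
                  z≤ , ≤z+1 = proj₂ (boxCell s j)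
              in same-cell⇒close (ι L) (p s j) (p t j) R (ι (toℕ (box t j)))
                   (subst (ℚ._≤ ι L ℚ.* (p s j ℚ.+ R)) z≡ z≤)
                   (subst (λ z → ι L ℚ.* (p s j ℚ.+ R) ℚ.≤ 1ℚ ℚ.+ z) z≡ ≤z+1)
                   (proj₁ (proj₂ (boxCell t j))) (proj₂ (proj₂ (boxCell t j))))
           2ᵏη≤1 gap

  -- Comparison of exponential growth rates

  *-^-distrib : ∀ a b n → (a ℕ.* b) ^ n ≡ a ^ n ℕ.* b ^ n
  *-^-distrib a b zero    = refl
  *-^-distrib a b (suc n) = trans (cong (a ℕ.* b ℕ.*_) (*-^-distrib a b n)) (ℕ.[m*n]*[o*p]≡[m*o]*[n*p] a b (a ^ n) (b ^ n))

  -- The inequality 1 + k/b ≤ (1 + 1/b)ᵏ with denominators cleared.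
  bernoulli : ∀ b k → b ^ k ℕ.* (b ℕ.+ k) ℕ.≤ b ℕ.* suc b ^ k
  bernoulli b zero    = ℕ.≤-reflexive (trans (ℕ.*-identityˡ (b ℕ.+ 0)) (trans (ℕ.+-identityʳ b) (sym (ℕ.*-identityʳ b))))
  bernoulli b (suc k) = begin
    b ℕ.* b ^ k ℕ.* (b ℕ.+ suc k)                      ≤⟨ ℕ.m≤m+n _ (b ^ k ℕ.* k) ⟩
    b ℕ.* b ^ k ℕ.* (b ℕ.+ suc k) ℕ.+ b ^ k ℕ.* k          ≡⟨ eq b (b ^ k) k ⟩
    suc b ℕ.* (b ^ k ℕ.* (b ℕ.+ k))                    ≤⟨ ℕ.*-monoʳ-≤ (suc b) (bernoulli b k) ⟩
    suc b ℕ.* (b ℕ.* suc b ^ k)                      ≡⟨ eq′ (suc b) b (suc b ^ k) ⟩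
    b ℕ.* (suc b ℕ.* suc b ^ k)                      ∎
    where
    open ℕ.≤-Reasoning
    eq : ∀ b p k → b ℕ.* p ℕ.* (b ℕ.+ suc k) ℕ.+ p ℕ.* k ≡ suc b ℕ.* (p ℕ.* (b ℕ.+ k))
    eq = solve-∀
    eq′ : ∀ a b c → a ℕ.* (b ℕ.* c) ≡ b ℕ.* (a ℕ.* c)
    eq′ = solve-∀

  exponential-growth : ∀ N b C .{{_ : NonZero b}} → (∀ k → N ^ k ℕ.≤ C ℕ.* b ^ k) → N ℕ.≤ b
  exponential-growth N b C bound = ℕ.≮⇒≥ λ b<N →
    -- For this exponent the upper bound b · C · bᵏ is exactly bᵏ · k, while `bernoulli` with N > b
    -- demands at least bᵏ · (b + k).
    let k = C ℕ.* b
        open ℕ.≤-Reasoning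
        le : b ^ k ℕ.* b ℕ.+ b ^ k ℕ.* k ℕ.≤ 0 ℕ.+ b ^ k ℕ.* k
        le = begin
          b ^ k ℕ.* b ℕ.+ b ^ k ℕ.* k    ≡⟨ ℕ.*-distribˡ-+ (b ^ k) b k ⟨
          b ^ k ℕ.* (b ℕ.+ k)          ≤⟨ bernoulli b k ⟩
          b ℕ.* suc b ^ k            ≤⟨ ℕ.*-monoʳ-≤ b (ℕ.^-monoˡ-≤ k b<N) ⟩
          b ℕ.* N ^ k                ≤⟨ ℕ.*-monoʳ-≤ b (bound k) ⟩
          b ℕ.* (C ℕ.* b ^ k)          ≡⟨ eq b C (b ^ k) ⟩
          0 ℕ.+ b ^ k ℕ.* k            ∎
    in contradiction (ℕ.+-cancelʳ-≤ _ _ _ le)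
         (ℕ.<⇒≱ (ℕ.*-mono-< (ℕ.m^n>0 b k) (>-nonZero⁻¹ b)))
    where
    eq : ∀ b C p → b ℕ.* (C ℕ.* p) ≡ p ℕ.* (C ℕ.* b)
    eq = solve-∀

  open import Algebra.Properties.Semiring.Sum (CommutativeRing.semiring ℝ-commutativeRing)
    using (sum-cong-≋; *-distribˡ-sum; *-distribʳ-sum; ∑-comm; ∑-distrib-+)
  open CommutativeRing ℝ-commutativeRing
    using (setoid; *-comm; *-assoc; *-identityˡ; *-identityʳ; zeroˡ; +-identityˡ; +-identityʳ; -‿inverseʳ)

  -- Limits and finite families

  -- Denominators are at least 1, so the absolute value of the numerator already serves as
  -- threshold.
  ι-archimedean : ∀ q → Eventually λ n → q ℚ.≤ ι n
  ι-archimedean q@(ℚ.mkℚ p e-1 _) = ℤ.∣ p ∣ , λ n ∣p∣≤n → ℚ.≤-trans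
    (ℚ.toℚᵘ-cancel-≤ (ℚᵘ.≤-trans (ℚᵘ.*≤* (ℤ.≤-trans (ℤ.≤-reflexive (ℤ.*-identityʳ p)) (p≤∣p∣*e)))
                                  (ℚᵘ.≤-reflexive (ℚᵘ.≃-sym (toℚᵘ-ι ℤ.∣ p ∣)))))
    (ι-mono-≤ ∣p∣≤n)
    where
    toℚᵘ-ι : ∀ n → ℚ.toℚᵘ (ι n) ℚᵘ.≃ ℚᵘ.mkℚᵘ (+ n) 0
    toℚᵘ-ι zero    = ℚᵘ.≃-refl
    toℚᵘ-ι (suc n) = ℚᵘ.≃-trans (ℚ.toℚᵘ-homo-+ 1ℚ (ι n)) (ℚᵘ.≃-trans (ℚᵘ.+-congʳ ℚᵘ.1ℚᵘ (toℚᵘ-ι n))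
      (ℚᵘ.*≡* (cong (λ i → (+ 1 ℤ.+ i) ℤ.* + 1) (ℤ.*-identityʳ (+ n)))))
    i≤∣i∣ : ∀ i → i ℤ.≤ + ℤ.∣ i ∣
    i≤∣i∣ (+ n)      = ℤ.≤-refl
    i≤∣i∣ ℤ.-[1+ n ] = ℤ.-≤+
    p≤∣p∣*e : p ℤ.≤ + ℤ.∣ p ∣ ℤ.* + suc e-1
    p≤∣p∣*e = ℤ.≤-trans (i≤∣i∣ p) (subst (+ ℤ.∣ p ∣ ℤ.≤_) (ℤ.pos-* ℤ.∣ p ∣ (suc e-1)) (ℤ.+≤+ (ℕ.m≤m*n ℤ.∣ p ∣ (suc e-1))))

  eventually-∀ : ∀ {k} {P : Fin k → Pred ℕ 0ℓ} → (∀ i → Eventually (P i)) → Eventually λ n → ∀ i → P i n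
  eventually-∀ {zero}  ev = always λ _ ()
  eventually-∀ {suc k} ev = eventually-map₂ (λ n p ps → λ { zero → p ; (suc i) → ps i })
                              (ev zero) (eventually-∀ (λ i → ev (suc i)))

  -- Double-negation shift, available because the index set is finite. It allows all pairs of
  -- vertices to be treated simultaneously.
  ¬¬-∀ : ∀ {k} {P : Fin k → Set} → (∀ i → ¬ ¬ P i) → ¬ ¬ (∀ i → P i)
  ¬¬-∀ {zero}  h ¬all = ¬all λ ()
  ¬¬-∀ {suc k} h ¬all = h zero λ p → ¬¬-∀ (λ i → h (suc i)) λ ps → ¬all λ { zero → p ; (suc i) → ps i }

  -- The linear algebra of points

  ≋-refl : ∀ {d} {x : Point d} → x ≋ x
  ≋-refl i = ≈-refl

  ≋-sym : ∀ {d} {x y : Point d} → x ≋ y → y ≋ x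
  ≋-sym p i = ≈-sym (p i)

  ≋-trans : ∀ {d} {x y z : Point d} → x ≋ y → y ≋ z → x ≋ z
  ≋-trans p q i = ≈-trans (p i) (q i)

  -ᵛ-cong : ∀ {d} {x y : Point d} → x ≋ y → -ᵛ x ≋ -ᵛ y
  -ᵛ-cong p i = neg-cong (p i)

  -ᵛ-involutive : ∀ {d} (x : Point d) → -ᵛ (-ᵛ x) ≋ x
  -ᵛ-involutive x i = neg-involutive (x i)

  sum-cong : ∀ {k} {f g : Vector ℝ k} → (∀ i → f i ≈ g i) → sum f ≈ sum g
  sum-cong {f = f} {g} = sum-cong-≋ {_} {f} {g}

  ∙-congʳ : ∀ {d} (a : Point d) {x y} → x ≋ y → a ∙ x ≈ a ∙ y
  ∙-congʳ a {x} {y} p = sum-cong λ i → *-cong (≈-refl {a i}) (p i)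

  seq-sum : ∀ {k} (f : Vector ℝ k) n → seq (sum f) n ≡ sumℚ (λ i → seq (f i) n)
  seq-sum {zero}  f n = refl
  seq-sum {suc k} f n = cong (seq (f zero) n ℚ.+_) (seq-sum (λ i → f (suc i)) n)

  sampleᵛ : ∀ {d} → ℕ → Point d → Vector ℚ d
  sampleᵛ n x j = seq (x j) n

  seq-∙ : ∀ {d} (a x : Point d) n → seq (a ∙ x) n ≡ dot (sampleᵛ n a) (sampleᵛ n x)
  seq-∙ a x n = seq-sum (λ j → a j * x j) n

  sum-neg : ∀ {k} (f : Vector ℝ k) → sum (λ i → - f i) ≈ - sum f
  sum-neg {zero}  f = ≈-pointwise λ n → refl
  sum-neg {suc k} f = ≈-trans (+-cong ≈-refl (sum-neg (λ i → f (suc i))))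
    (≈-pointwise λ n → sym (ℚ.neg-distrib-+ (seq (f zero) n) (seq (sum (λ i → f (suc i))) n)))

  ∙-negʳ : ∀ {d} (a x : Point d) → a ∙ -ᵛ x ≈ - (a ∙ x)
  ∙-negʳ a x = ≈-trans
    (sum-cong λ i → ≈-pointwise λ n → sym (ℚ.neg-distribʳ-* (seq (a i) n) (seq (x i) n)))
    (sum-neg λ i → a i * x i)

  ∙-negˡ : ∀ {d} (a x : Point d) → -ᵛ a ∙ x ≈ - (a ∙ x)
  ∙-negˡ a x = ≈-trans
    (sum-cong λ i → ≈-pointwise λ n → sym (ℚ.neg-distribˡ-* (seq (a i) n) (seq (x i) n)))
    (sum-neg λ i → a i * x i)

  hull-resp-≋ : ∀ {d k} (g : Vector (Point d) k) {x y} → x ≋ y → x ∈ ConvexHull g → y ∈ ConvexHull g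
  hull-resp-≋ g x≋y (μ , μ≥0 , sum≈1 , comb≋x) = μ , μ≥0 , sum≈1 , ≋-trans comb≋x x≋y

  Positive-2 : Positive (fromℚ 2ℚ)
  Positive-2 = 1ℚ , 0<1ℚ , always λ _ → ℚ.+-monoʳ-< 1ℚ 0<1ℚ

  x≈-x⇒x≈0 : ∀ {x} → x ≈ - x → x ≈ 0ℝ
  x≈-x⇒x≈0 {x} x≈-x = Positive-*≈0 {fromℚ 2ℚ} Positive-2
    (≈-trans (≈-pointwise λ n → eq (seq x n)) (≈-trans (+-cong (≈-refl {x}) x≈-x) (-‿inverseʳ x)))
    where
    eq : ∀ a → 2ℚ ℚ.* a ≡ a ℚ.+ a
    eq = solve 1 (λ a → con 2ℚ :* a := a :+ a) refl

  -- From a separating face to rational separation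

  -- A slab of half-width `offset` containing all the points, with `v x` on one boundary hyperplane
  -- and `v y` on the other. `positive` is a mere negation because a proper face yields no explicit
  -- lower bound on its offset.
  record Separating {d N} (v : Vector (Point d) N) (x y : Fin N) : Set where
    field
      normal   : Point d
      offset   : ℝ
      upper    : ∀ l → normal ∙ v l ≤ offset
      lower    : ∀ l → - (normal ∙ v l) ≤ offset
      high     : offset ≤ normal ∙ v x
      low      : offset ≤ - (normal ∙ v y)
      positive : ¬ offset ≤ 0ℝ

  reciprocal : ∀ {q c} → 0ℚ ℚ.< q → q ℚ.< c → ∃[ r ] 0ℚ ℚ.< r × r ℚ.* c ≡ 1ℚ × r ℚ.* q ℚ.≤ 1ℚ
  reciprocal {q} {c} q>0 q<c =
    let r , r>0 , cr≡1 = divide (ℚ.<-trans q>0 q<c) 0<1ℚ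
        rc≡1 = trans (ℚ.*-comm r c) cr≡1
    in r , r>0 , rc≡1 , subst (r ℚ.* q ℚ.≤_) rc≡1 (ℚ.*-monoˡ-≤-nonNeg r {{ℚ.nonNegative (ℚ.<⇒≤ r>0)}} (ℚ.<⇒≤ q<c))

  -- Dividing by c > q turns the slack qη into at most η. Hence the tolerance can be prescribed
  -- before the sampled offset c is known.
  scale-upper : ∀ {q c r η X} → 0ℚ ℚ.< r → r ℚ.* c ≡ 1ℚ → r ℚ.* q ℚ.≤ 1ℚ → 0ℚ ℚ.≤ η →
                X ℚ.< c ℚ.+ q ℚ.* η → r ℚ.* X ℚ.≤ 1ℚ ℚ.+ η
  scale-upper {q} {c} {r} {η} {X} r>0 rc≡1 rq≤1 η≥0 X< = begin
    r ℚ.* X                         ≤⟨ ℚ.*-monoˡ-≤-nonNeg r {{ℚ.nonNegative (ℚ.<⇒≤ r>0)}} (ℚ.<⇒≤ X<) ⟩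
    r ℚ.* (c ℚ.+ q ℚ.* η)           ≡⟨ eq r c q η ⟩
    r ℚ.* c ℚ.+ r ℚ.* q ℚ.* η       ≤⟨ ℚ.+-mono-≤ (ℚ.≤-reflexive rc≡1) (ℚ.*-monoʳ-≤-nonNeg η {{ℚ.nonNegative η≥0}} rq≤1) ⟩
    1ℚ ℚ.+ 1ℚ ℚ.* η                 ≡⟨ cong (1ℚ ℚ.+_) (ℚ.*-identityˡ η) ⟩
    1ℚ ℚ.+ η                        ∎
    where
    open ℚ.≤-Reasoning
    eq : ∀ r c q η → r ℚ.* (c ℚ.+ q ℚ.* η) ≡ r ℚ.* c ℚ.+ r ℚ.* q ℚ.* η
    eq = solve 4 (λ r c q η → r :* (c :+ q :* η) := r :* c :+ r :* q :* η) refl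

  scale-lower : ∀ {q c r η X} → 0ℚ ℚ.< r → r ℚ.* c ≡ 1ℚ → r ℚ.* q ℚ.≤ 1ℚ → 0ℚ ℚ.≤ η →
                c ℚ.< X ℚ.+ q ℚ.* η → 1ℚ ℚ.- η ℚ.≤ r ℚ.* X
  scale-lower {q} {c} {r} {η} {X} r>0 rc≡1 rq≤1 η≥0 c< = lin≤
    (ℚ.+-mono-≤ (ℚ.*-monoˡ-≤-nonNeg r {{ℚ.nonNegative (ℚ.<⇒≤ r>0)}} (ℚ.<⇒≤ c<))
                (ℚ.*-monoʳ-≤-nonNeg η {{ℚ.nonNegative η≥0}} rq≤1))
    (trans (cong (λ u → (u ℚ.- η) ℚ.+ (r ℚ.* (X ℚ.+ q ℚ.* η) ℚ.+ 1ℚ ℚ.* η)) (sym rc≡1)) (eq r X q η (r ℚ.* c)))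
    where
    eq : ∀ r X q η u → (u ℚ.- η) ℚ.+ (r ℚ.* (X ℚ.+ q ℚ.* η) ℚ.+ 1ℚ ℚ.* η) ≡ r ℚ.* X ℚ.+ (u ℚ.+ r ℚ.* q ℚ.* η)
    eq = solve 5 (λ r X q η u → (u :- η) :+ (r :* (X :+ q :* η) :+ con 1ℚ :* η) := r :* X :+ (u :+ r :* q :* η)) refl

  module _ {d N} (v : Vector (Point d) N) where

    -- The threshold for `L` precedes η and the sampling index `n`: `L` enters the constant of the
    -- growth estimate, while η has to shrink like 2⁻ᵏ.
    NearlySeparable : Fin N → Fin N → Set
    NearlySeparable x y = Eventually λ L → ∀ η → 0ℚ ℚ.< η → Eventually λ n →
      NearlySeparating (λ l → sampleᵛ n (v l)) (ι L) η x y

    separating⇒nearly : ∀ {x y} → Separating v x y → ¬ ¬ NearlySeparable x y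
    separating⇒nearly {x} {y} S ¬near = positive (¬Positive⇒≤0 λ pos → ¬near (go pos))
      where
      open Separating S
      A = λ j → proj₁ (eventually-bounded (normal j))
      go : Positive offset → NearlySeparable x y
      go (q , q>0 , q<c) =
        -- The sampled normal has ℓ¹ norm at most ΣA and is divided by an offset above q, so δ = (1
        -- + ΣA)/q bounds the result. The added 1 gives `divide` a positive dividend.
        let δ , _ , qδ≡ = divide q>0 A>0
        in eventually-map (λ L δ≤L η η>0 →
             let ε>0 = 0<* q>0 η>0 in
             eventually-map₂ (λ n (q<cn , a<) ((up , lo) , (hi , lw)) → at n δ qδ≡ L δ≤L η (ℚ.<⇒≤ η>0) q<cn a< up lo hi lw)
               (eventually-map₂ (λ _ → _,_) q<c (eventually-∀ λ j → proj₂ (proj₂ (eventually-bounded (normal j)))))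
               (eventually-map₂ (λ _ → _,_)
                 (eventually-map₂ (λ _ → _,_) (eventually-∀ λ l → below (upper l) _ ε>0) (eventually-∀ λ l → below (lower l) _ ε>0))
                 (eventually-map₂ (λ _ → _,_) (below high _ ε>0) (below low _ ε>0))))
           (ι-archimedean δ)
        where
        A>0 : 0ℚ ℚ.< 1ℚ ℚ.+ sumℚ A
        A>0 = ℚ.+-mono-<-≤ 0<1ℚ (sumA≥0 A λ j → ℚ.<⇒≤ (proj₁ (proj₂ (eventually-bounded (normal j)))))
          where
          sumA≥0 : ∀ {k} (f : Vector ℚ k) → (∀ i → 0ℚ ℚ.≤ f i) → 0ℚ ℚ.≤ sumℚ f
          sumA≥0 {zero}  f f≥0 = ℚ.≤-refl
          sumA≥0 {suc k} f f≥0 = ℚ.+-mono-≤ (f≥0 zero) (sumA≥0 (λ i → f (suc i)) (λ i → f≥0 (suc i)))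
        at : ∀ n δ → q ℚ.* δ ≡ 1ℚ ℚ.+ sumℚ A → ∀ L → δ ℚ.≤ ι L → ∀ η → 0ℚ ℚ.≤ η → q ℚ.< seq offset n →
             (∀ j → ℚ.∣ seq (normal j) n ∣ ℚ.< A j) →
             (∀ l → seq (normal ∙ v l) n ℚ.< seq offset n ℚ.+ q ℚ.* η) →
             (∀ l → ℚ.- seq (normal ∙ v l) n ℚ.< seq offset n ℚ.+ q ℚ.* η) →
             seq offset n ℚ.< seq (normal ∙ v x) n ℚ.+ q ℚ.* η →
             seq offset n ℚ.< ℚ.- seq (normal ∙ v y) n ℚ.+ q ℚ.* η →
             NearlySeparating (λ l → sampleᵛ n (v l)) (ι L) η x y
        at n δ qδ≡ L δ≤L η η≥0 q<c a<A up lo hi lw = record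
          { normal = a′
          ; upper = λ l → subst (ℚ._≤ 1ℚ ℚ.+ η) (sym (value l)) (scale-upper r>0 rc≡1 rq≤1 η≥0 (up l))
          ; lower = λ l → subst (ℚ._≤ 1ℚ ℚ.+ η) (sym (-value l)) (scale-upper r>0 rc≡1 rq≤1 η≥0 (lo l))
          ; high = subst (1ℚ ℚ.- η ℚ.≤_) (sym (value x)) (scale-lower r>0 rc≡1 rq≤1 η≥0 hi)
          ; low = subst (1ℚ ℚ.- η ℚ.≤_) (sym (-value y)) (scale-lower r>0 rc≡1 rq≤1 η≥0 lw)
          ; small = small }
          where
          rec = reciprocal q>0 q<c
          r = proj₁ rec
          r>0 = proj₁ (proj₂ rec)
          rc≡1 = proj₁ (proj₂ (proj₂ rec))
          rq≤1 = proj₂ (proj₂ (proj₂ rec))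
          a = sampleᵛ n normal
          a′ = λ j → r ℚ.* a j
          value : ∀ l → dot a′ (sampleᵛ n (v l)) ≡ r ℚ.* seq (normal ∙ v l) n
          value l = trans (sumℚ-cong λ j → ℚ.*-assoc r (a j) (seq (v l j) n))
            (trans (sym (*-distribˡ-sumℚ r (λ j → a j ℚ.* seq (v l j) n))) (cong (r ℚ.*_) (sym (seq-∙ normal (v l) n))))
          -value : ∀ l → ℚ.- dot a′ (sampleᵛ n (v l)) ≡ r ℚ.* (ℚ.- seq (normal ∙ v l) n)
          -value l = trans (cong ℚ.-_ (value l)) (ℚ.neg-distribʳ-* r (seq (normal ∙ v l) n))
          small : sumℚ (λ j → ℚ.∣ r ℚ.* a j ∣) ℚ.≤ ι L
          small = begin
            sumℚ (λ j → ℚ.∣ r ℚ.* a j ∣)        ≡⟨ sumℚ-cong (λ j → trans (ℚ.∣p*q∣≡∣p∣*∣q∣ r (a j)) (cong (ℚ._* ℚ.∣ a j ∣) (ℚ.0≤p⇒∣p∣≡p (ℚ.<⇒≤ r>0)))) ⟩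
            sumℚ (λ j → r ℚ.* ℚ.∣ a j ∣)        ≡⟨ *-distribˡ-sumℚ r (λ j → ℚ.∣ a j ∣) ⟨
            r ℚ.* sumℚ (λ j → ℚ.∣ a j ∣)        ≤⟨ ℚ.*-monoˡ-≤-nonNeg r {{r≥0}} (ℚ.≤-trans (sumℚ-mono-≤ (λ j → ℚ.<⇒≤ (a<A j))) sum≤1+sum) ⟩
            r ℚ.* (1ℚ ℚ.+ sumℚ A)               ≡⟨ cong (r ℚ.*_) qδ≡ ⟨
            r ℚ.* (q ℚ.* δ)                     ≤⟨ ℚ.*-monoˡ-≤-nonNeg r {{r≥0}} (ℚ.*-monoˡ-≤-nonNeg q {{ℚ.nonNegative (ℚ.<⇒≤ q>0)}} δ≤L) ⟩
            r ℚ.* (q ℚ.* ι L)                   ≡⟨ ℚ.*-assoc r q (ι L) ⟨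
            r ℚ.* q ℚ.* ι L                     ≤⟨ ℚ.*-monoʳ-≤-nonNeg (ι L) {{ℚ.nonNegative (0≤ι L)}} rq≤1 ⟩
            1ℚ ℚ.* ι L                          ≡⟨ ℚ.*-identityˡ (ι L) ⟩
            ι L                                 ∎
            where
            open ℚ.≤-Reasoning
            r≥0 = ℚ.nonNegative (ℚ.<⇒≤ r>0)
            sum≤1+sum : sumℚ A ℚ.≤ 1ℚ ℚ.+ sumℚ A
            sum≤1+sum = subst (ℚ._≤ 1ℚ ℚ.+ sumℚ A) (ℚ.+-identityˡ (sumℚ A)) (ℚ.+-monoˡ-≤ (sumℚ A) (ℚ.<⇒≤ 0<1ℚ))

    coordinates-bounded : Eventually λ M → Eventually λ n → ∀ l j → ℚ.∣ seq (v l j) n ∣ ℚ.≤ ι M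
    coordinates-bounded =
      eventually-map (λ M ev → eventually-∀ λ l → eventually-∀ λ j → ev l j)
        (eventually-∀ λ l → eventually-∀ λ j →
          let B , _ , x<B = eventually-bounded (v l j)
          in eventually-map (λ M B≤M → eventually-map (λ n x<B → ℚ.≤-trans (ℚ.<⇒≤ x<B) B≤M) x<B) (ι-archimedean B))

    separating⇒bound : (∀ x y → x ≢ y → Separating v x y) → N ℕ.≤ 2 ^ d
    separating⇒bound sep = decidable-stable (N ℕ.≤? 2 ^ d) λ N≰2ᵈ →
      ¬¬-∀ (λ x → ¬¬-∀ λ y → nearly x y (x Fin.≟ y)) λ near → N≰2ᵈ (bound near)
      where
      -- With `x ≢ y` as the innermost hypothesis the diagonal holds vacuously, and `eventually-∀`
      -- can extract one `L` and one `n` common to all pairs.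
      OffDiagonal : Fin N → Fin N → Set
      OffDiagonal x y = Eventually λ L → ∀ η → 0ℚ ℚ.< η → Eventually λ n →
        x ≢ y → NearlySeparating (λ l → sampleᵛ n (v l)) (ι L) η x y

      nearly : ∀ x y → Dec (x ≡ y) → ¬ ¬ OffDiagonal x y
      nearly x y (yes x≡y) k = k (always λ _ _ _ → always λ _ x≢y → contradiction x≡y x≢y)
      nearly x y (no x≢y)  k = separating⇒nearly (sep x y x≢y) λ near →
        k (eventually-map (λ L h η η>0 → eventually-map (λ n s _ → s) (h η η>0)) near)

      bound : (∀ x y → OffDiagonal x y) → N ℕ.≤ 2 ^ d
      bound near = exponential-growth N (2 ^ d) ((L ℕ.* (2 ℕ.* M)) ^ d) {{ℕ.m^n≢0 2 d}} λ k →
        -- With η = 2⁻⁽ᵏ⁺¹⁾ the accumulated error is exactly 1, the most that the packing argument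
        -- tolerates.
        let η , η>0 , 2ᵏη≡1 = divide (0<ι (2 ^ suc k) {{ℕ.m^n≢0 2 (suc k)}}) 0<1ℚ
            n , sep , v≤M = eventually-inhabited (eventually-map₂ (λ _ → _,_)
              (eventually-∀ λ x → eventually-∀ λ y → proj₂ near∀ L (ℕ.n≤1+n _) x y η η>0)
              (proj₂ coordinates-bounded M (ℕ.n≤1+n _)))
        in subst (N ^ k ℕ.≤_) (regroup k)
             (packing-bound (λ l → sampleᵛ n (v l)) L M k η>0 (ℚ.≤-reflexive 2ᵏη≡1) v≤M sep)
        where
        near∀ = eventually-∀ λ x → eventually-∀ λ y → near x y
        -- Passing to the successor makes both constants visibly nonzero and keeps them beyond their
        -- thresholds.
        L = suc (proj₁ near∀)
        M = suc (proj₁ coordinates-bounded)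
        regroup : ∀ k → (L ℕ.* (2 ^ suc k ℕ.* M)) ^ d ≡ (L ℕ.* (2 ℕ.* M)) ^ d ℕ.* (2 ^ d) ^ k
        regroup k = begin
          (L ℕ.* (2 ℕ.* 2 ^ k ℕ.* M)) ^ d           ≡⟨ cong (_^ d) (eq L (2 ^ k) M) ⟩
          (L ℕ.* (2 ℕ.* M) ℕ.* 2 ^ k) ^ d           ≡⟨ *-^-distrib (L ℕ.* (2 ℕ.* M)) (2 ^ k) d ⟩
          (L ℕ.* (2 ℕ.* M)) ^ d ℕ.* (2 ^ k) ^ d     ≡⟨ cong ((L ℕ.* (2 ℕ.* M)) ^ d ℕ.*_) (trans (ℕ.^-*-assoc 2 k d)
                                                         (trans (cong (2 ^_) (ℕ.*-comm k d)) (sym (ℕ.^-*-assoc 2 d k)))) ⟩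
          (L ℕ.* (2 ℕ.* M)) ^ d ℕ.* (2 ^ d) ^ k     ∎
          where
          open ≡-Reasoning
          eq : ∀ L p M → L ℕ.* (2 ℕ.* p ℕ.* M) ≡ L ℕ.* (2 ℕ.* M) ℕ.* p
          eq = solve-∀

  -- Families without antipodal pairs

  -- Vertices are replaced by their indices, where equality is decidable. Only distinct positions
  -- are compared, as in the field `faces`; that no index is its own antipode is shown separately.
  AntipodeFree : ∀ {N k} → (Fin N → Fin N) → Vector (Fin N) k → Set
  AntipodeFree σ u = Injective _≡_ _≡_ u × (∀ s t → s ≢ t → u s ≢ σ (u t))

  module _ {N} (σ : Fin N → Fin N) (σ-involutive : ∀ i → σ (σ i) ≡ i) where

    -- The entries and their antipodes number at most 2k. If they covered everything, recording an
    -- entry and a side for each index would inject `Fin N` into `Fin (2 * k)`.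
    uncovered : ∀ {k} (u : Vector (Fin N) k) → 2 ℕ.* k ℕ.< N → ∃[ z ] ∀ s → z ≢ u s × z ≢ σ (u s)
    uncovered {k} u 2k<N with Fin.all? (λ z → Fin.any? λ s → (z Fin.≟ u s) ⊎-dec (z Fin.≟ σ (u s)))
    ... | yes covered = contradiction (Fin.injective⇒≤ code-injective) (ℕ.<⇒≱ 2k<N)
      where
      side : ∀ {z s} → z ≡ u s ⊎ z ≡ σ (u s) → Fin 2
      side (inj₁ _) = zero
      side (inj₂ _) = suc zero

      point : Fin 2 → Fin k → Fin N
      point zero    s = u s
      point (suc _) s = σ (u s)

      point-side : ∀ {z s} (h : z ≡ u s ⊎ z ≡ σ (u s)) → point (side h) s ≡ z
      point-side (inj₁ z≡) = sym z≡
      point-side (inj₂ z≡) = sym z≡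

      code : Fin N → Fin (2 ℕ.* k)
      code z = combine (side (proj₂ (covered z))) (proj₁ (covered z))

      code-injective : Injective _≡_ _≡_ code
      code-injective {y} {z} code≡ =
        let side≡ , s≡ = Fin.combine-injective (side (proj₂ (covered y))) (proj₁ (covered y)) (side (proj₂ (covered z))) (proj₁ (covered z)) code≡
        in trans (sym (point-side (proj₂ (covered y)))) (trans (cong₂ point side≡ s≡) (point-side (proj₂ (covered z))))
    ... | no ¬covered =
      let z , ¬∃ = Fin.¬∀⟶∃¬ N _ (λ z → Fin.any? λ s → (z Fin.≟ u s) ⊎-dec (z Fin.≟ σ (u s))) ¬covered
      in z , λ s → (λ z≡ → ¬∃ (s , inj₁ z≡)) , (λ z≡ → ¬∃ (s , inj₂ z≡))

    ∷-antipodeFree : ∀ {k z} {u : Vector (Fin N) k} → AntipodeFree σ u → (∀ s → z ≢ u s × z ≢ σ (u s)) →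
                     AntipodeFree σ (z ∷ u)
    ∷-antipodeFree {k} {z} {u} (inj , free) fresh = inj′ , free′
      where
      inj′ : Injective _≡_ _≡_ (z ∷ u)
      inj′ {zero}  {zero}  _   = refl
      inj′ {zero}  {suc t} z≡  = contradiction z≡ (proj₁ (fresh t))
      inj′ {suc s} {zero}  ≡z  = contradiction (sym ≡z) (proj₁ (fresh s))
      inj′ {suc s} {suc t} u≡u = cong suc (inj u≡u)

      free′ : ∀ s t → s ≢ t → (z ∷ u) s ≢ σ ((z ∷ u) t)
      free′ zero    zero    s≢t _  = s≢t refl
      free′ zero    (suc t) _   z≡ = proj₂ (fresh t) z≡
      free′ (suc s) zero    _   ≡z = proj₂ (fresh s) (trans (sym (σ-involutive z)) (cong σ (sym ≡z)))
      free′ (suc s) (suc t) s≢t    = free s t (s≢t ∘ cong suc)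

    -- Fresh indices are added greedily while room remains. This embeds a non-antipodal pair in a
    -- family of the size for which neighborliness provides a face.
    antipodeFree-extend : ∀ k {x y} → x ≢ y → x ≢ σ y → 2 ℕ.* (2 ℕ.+ k) ℕ.≤ N →
      Σ[ u ∈ Vector (Fin N) (2 ℕ.+ k) ] AntipodeFree σ u × (∃[ s ] u s ≡ x) × (∃[ t ] u t ≡ y)
    antipodeFree-extend zero {x} {y} x≢y x≢σy _ =
      (x ∷ y ∷ []) ,
      ∷-antipodeFree (∷-antipodeFree ((λ { {()} }) , λ ()) (λ ())) (λ { zero → x≢y , x≢σy ; (suc ()) }) ,
      (zero , refl) , (suc zero , refl)
    antipodeFree-extend (suc k) x≢y x≢σy 2k≤N =
      let 2k<N = ℕ.<-≤-trans (ℕ.*-monoʳ-< 2 (ℕ.n<1+n (2 ℕ.+ k))) 2k≤N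
          u , free , (s , us≡x) , (t , ut≡y) = antipodeFree-extend k x≢y x≢σy (ℕ.<⇒≤ 2k<N)
          z , fresh = uncovered u 2k<N
      in z ∷ u , ∷-antipodeFree free fresh , (suc s , us≡x) , (suc t , ut≡y)

  -- Faces of centrally symmetric polytopes

  vertex∈ : ∀ {d} {X : Pred (Point d) 0ℓ} {x} → IsVertex X x → x ∈ X
  vertex∈ (F , _ , ⊇) = proj₁ (⊇ ≋-refl)

  module _ {d k} (g : Vector (Point d) k) (symmetric : ∀ x → x ∈ ConvexHull g → -ᵛ x ∈ ConvexHull g) where

    private X = ConvexHull g

    -- The reflected functional, with the same offset, exposes the reflected point.
    antipodal-vertex : ∀ {x} → IsVertex X x → IsVertex X (-ᵛ x)
    antipodal-vertex {x} (F , ⊆ , ⊇) = record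
      { normal = -ᵛ normal
      ; offset = offset
      ; valid = λ {y} y∈X → ≤-trans (≈⇒≤ (-∙ y)) (valid (symmetric y y∈X)) } ,
      (λ {y} (y∈X , eq) → ≋-trans (≋-sym (-ᵛ-involutive y))
         (-ᵛ-cong (⊆ (symmetric y y∈X , ≈-trans (≈-sym (-∙ y)) eq)))) ,
      (λ {y} y≋-x →
         let -y∈X , eq = ⊇ (≋-trans (-ᵛ-cong y≋-x) (-ᵛ-involutive x))
         in hull-resp-≋ g (-ᵛ-involutive y) (symmetric _ -y∈X) , ≈-trans (-∙ y) eq)
      where
      open Face F using (normal; offset; valid)
      -∙ : ∀ y → -ᵛ normal ∙ y ≈ normal ∙ -ᵛ y
      -∙ y = ≈-trans (∙-negˡ normal y) (≈-sym (∙-negʳ normal y))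

    -∙≤offset : (F : Face X) → ∀ {y} → y ∈ X → - (Face.normal F ∙ y) ≤ Face.offset F
    -∙≤offset F {y} y∈X = ≤-trans (≈⇒≥ (∙-negʳ (Face.normal F) y)) (Face.valid F (symmetric y y∈X))

    -- By symmetry -(a ∙ y) ≤ c as well. If c ≤ 0, this forces a ∙ y ≥ 0 ≥ c, so the bound is
    -- attained everywhere.
    offset≤0⇒improper : (F : Face X) → Face.offset F ≤ 0ℝ → X ⊆ points F
    offset≤0⇒improper F c≤0 {y} y∈X = y∈X , ≤-antisym (valid y∈X) (≤-trans c≤0
      (≤-trans (≤-pointwise (always λ n → ℚ.≤-refl))
        (≤-trans (neg-antimono-≤ (≤-trans (-∙≤offset F y∈X) c≤0)) (≈⇒≤ (neg-involutive (normal ∙ y))))))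
      where
      open Face F using (normal; offset; valid)

    improper⇒vertex : (F : Face X) → X ⊆ points F → ∀ {x} → IsVertex X x → IsVertex (points F) x
    improper⇒vertex F X⊆F (G , ⊆ , ⊇) = record
      { normal = Face.normal G ; offset = Face.offset G ; valid = λ (y∈X , _) → Face.valid G y∈X } ,
      (λ ((y∈X , _) , eq) → ⊆ (y∈X , eq)) ,
      (λ y≋x → let y∈X , eq = ⊇ y≋x in X⊆F y∈X , eq)

  -- Separating the vertices of a `j`-neighborly polytope

  module _ {d j m} {P : Polytope d} (2≤j : 2 ℕ.≤ j) (neighborly : Neighborly j m P) where

    open Neighborly neighborly

    private
      N = 2 ℕ.* m
      v = proj₁ vertexCount

      injective : Injective _≡_ _≋_ v
      injective = proj₁ (proj₂ vertexCount)

      vertex : ∀ i → IsVertex (carrier P) (v i)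
      vertex i = Equivalence.from (proj₂ (proj₂ vertexCount) (v i)) (i , ≋-refl)

      v∈P : ∀ i → v i ∈ carrier P
      v∈P i = vertex∈ (vertex i)

      antipode : ∀ i → ∃[ i′ ] -ᵛ v i ≋ v i′
      antipode i = Equivalence.to (proj₂ (proj₂ vertexCount) (-ᵛ v i))
        (antipodal-vertex (Polytope.generators P) symmetric (vertex i))

      σ : Fin N → Fin N
      σ i = proj₁ (antipode i)

      v-σ : ∀ i → -ᵛ v i ≋ v (σ i)
      v-σ i = proj₂ (antipode i)

      σ-involutive : ∀ i → σ (σ i) ≡ i
      σ-involutive i = injective (≋-trans (≋-sym (v-σ (σ i)))
        (≋-trans (-ᵛ-cong (≋-sym (v-σ i))) (-ᵛ-involutive (v i))))

      vertexFace : ∀ i → Face (carrier P)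
      vertexFace i = proj₁ (vertex i)

      vertexFace-only : ∀ {i l} → v l ∈ points (vertexFace i) → l ≡ i
      vertexFace-only {i} l∈F = injective (proj₁ (proj₂ (vertex i)) l∈F)

      -- Otherwise the face exposing `v x` would contain `v y` too. The second vertex excludes the
      -- polytope {0}, whose vertex may be exposed with offset 0.
      vertexFace-proper : ∀ {x y} → x ≢ y → ¬ Face.offset (vertexFace x) ≤ 0ℝ
      vertexFace-proper {x} {y} x≢y c≤0 = x≢y (sym (vertexFace-only
        (offset≤0⇒improper (Polytope.generators P) symmetric (vertexFace x) c≤0 (v∈P y))))

      on-vertexFace : ∀ x → Face.normal (vertexFace x) ∙ v x ≈ Face.offset (vertexFace x)
      on-vertexFace x = proj₂ (proj₂ (proj₂ (vertex x)) ≋-refl)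

      -- A self-antipodal vertex has height 0 under every functional, so the face exposing it would
      -- have offset 0.
      σ-fixedPointFree : ∀ {x y} → x ≢ y → x ≢ σ x
      σ-fixedPointFree {x} x≢y x≡σx = vertexFace-proper x≢y
        (≤-trans (≈⇒≥ (on-vertexFace x)) (≈⇒≤ (x≈-x⇒x≈0 (≈-trans
          (∙-congʳ a (≋-trans (subst (λ i → v x ≋ v i) x≡σx ≋-refl) (≋-sym (v-σ x)))) (∙-negʳ a (v x))))))
        where a = Face.normal (vertexFace x)

      separating : (F : Face (carrier P)) → ∀ x y → v x ∈ points F → v (σ y) ∈ points F →
                   ¬ Face.offset F ≤ 0ℝ → Separating v x y
      separating F x y (_ , x∈F) (_ , σy∈F) proper = record
        { normal = normal
        ; offset = offset
        ; upper = λ l → valid (v∈P l)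
        ; lower = λ l → -∙≤offset (Polytope.generators P) symmetric F (v∈P l)
        ; high = ≈⇒≥ x∈F
        ; low = ≈⇒≥ (≈-trans (≈-sym (∙-negʳ normal (v y))) (≈-trans (∙-congʳ normal (v-σ y)) σy∈F))
        ; positive = proper }
        where open Face F using (normal; offset; valid)

      separate-antipodal : ∀ {x y} → x ≢ y → x ≡ σ y → Separating v x y
      separate-antipodal {x} {y} x≢y x≡σy =
        separating (vertexFace x) x y x∈F (subst (λ i → v i ∈ points (vertexFace x)) x≡σy x∈F) (vertexFace-proper x≢y)
        where
        x∈F : v x ∈ points (vertexFace x)
        x∈F = v∈P x , on-vertexFace x

      module _ (u : Vector (Fin N) j) (free : AntipodeFree σ u) where

        spannedFace : Σ[ F ∈ Face (carrier P) ] VertexSetIs (points F) (v ∘ u)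
        spannedFace = faces (v ∘ u) (proj₁ free ∘ injective) (λ i → vertex (u i))
          λ i l i≢l eq → proj₂ free i l i≢l (injective (≋-trans eq (v-σ (u l))))

        spannedFace∋ : ∀ i → v (u i) ∈ points (proj₁ spannedFace)
        spannedFace∋ i = vertex∈ (Equivalence.from (proj₂ spannedFace (v (u i))) (i , ≋-refl))

        -- Otherwise the face is all of P, so it contains the antipodes of its vertices too.
        spannedFace-proper : ∀ s {y} → u s ≢ y → ¬ Face.offset (proj₁ spannedFace) ≤ 0ℝ
        spannedFace-proper s {y} us≢y c≤0 = antipode∉ (proj₁ σx∈F) (injective (proj₂ σx∈F)) (proj₁ σx∈F Fin.≟ s)
          where
          σx∈F : ∃[ i ] v (σ (u s)) ≋ v (u i)
          σx∈F = Equivalence.to (proj₂ spannedFace (v (σ (u s))))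
            (improper⇒vertex (Polytope.generators P) symmetric (proj₁ spannedFace)
              (offset≤0⇒improper (Polytope.generators P) symmetric (proj₁ spannedFace) c≤0) (vertex (σ (u s))))
          antipode∉ : ∀ i → σ (u s) ≡ u i → Dec (i ≡ s) → ⊥
          antipode∉ i σx≡ui (yes refl) = σ-fixedPointFree us≢y (sym σx≡ui)
          antipode∉ i σx≡ui (no i≢s)   = proj₂ free i s i≢s (sym σx≡ui)

      separate-spanned : ∀ {x y} → x ≢ y → (u : Vector (Fin N) j) → AntipodeFree σ u →
                         ∃[ s ] u s ≡ x → ∃[ t ] u t ≡ σ y → Separating v x y
      separate-spanned {x} {y} x≢y u free (s , us≡x) (t , ut≡σy) =
        separating (proj₁ (spannedFace u free)) x y
          (subst (λ i → v i ∈ points (proj₁ (spannedFace u free))) us≡x (spannedFace∋ u free s))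
          (subst (λ i → v i ∈ points (proj₁ (spannedFace u free))) ut≡σy (spannedFace∋ u free t))
          (spannedFace-proper u free s (λ us≡y → x≢y (trans (sym us≡x) us≡y)))

      extend : ∀ k → 2 ℕ.+ k ≡ j → ∀ {x y} → x ≢ y → x ≢ σ y →
        Σ[ u ∈ Vector (Fin N) j ] AntipodeFree σ u × (∃[ s ] u s ≡ x) × (∃[ t ] u t ≡ y)
      extend k refl x≢y x≢σy = antipodeFree-extend σ σ-involutive k x≢y x≢σy (ℕ.*-monoʳ-≤ 2 k≤m)

      separate : ∀ x y → x ≢ y → Separating v x y
      separate x y x≢y = go (x Fin.≟ σ y)
        where
        go : Dec (x ≡ σ y) → Separating v x y
        go (yes x≡σy) = separate-antipodal x≢y x≡σy
        go (no x≢σy)  =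
          -- The family must contain x and σ y. These two are not antipodal exactly because σ (σ y)
          -- = y differs from x.
          let u , free , s , t = extend (j ℕ.∸ 2) (ℕ.m+[n∸m]≡n 2≤j) x≢σy λ x≡σσy → x≢y (trans x≡σσy (σ-involutive y))
          in separate-spanned x≢y u free s t

    -- No passage from `j` to 2 is needed: a separating face may contain further vertices, as long
    -- as it is proper.
    neighborly⇒bound : N ℕ.≤ 2 ^ d
    neighborly⇒bound = separating⇒bound v separate

  -- Finite sums of reals and strict positivity

  sum-zero : ∀ {k} {f : Vector ℝ k} → (∀ i → f i ≈ 0ℝ) → sum f ≈ 0ℝ
  sum-zero {zero}  f≈0 = ≈-refl
  sum-zero {suc k} f≈0 = ≈-trans (+-cong (f≈0 zero) (sum-zero λ i → f≈0 (suc i))) (+-identityˡ 0ℝ)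

  -- Associativity (μA)f = μ(Af). Taking f constantly 1 computes total weights, and taking a
  -- coordinate as f computes barycentres.
  sum-assoc : ∀ {k l} (μ : Vector ℝ k) (A : Fin k → Fin l → ℝ) (f : Vector ℝ l) →
    sum (λ j → sum (λ i → μ i * A i j) * f j) ≈ sum (λ i → μ i * sum (λ j → A i j * f j))
  sum-assoc μ A f = begin
    sum (λ j → sum (λ i → μ i * A i j) * f j)
      ≈⟨ sum-cong (λ j → *-distribʳ-sum (f j) (λ i → μ i * A i j)) ⟩
    sum (λ j → sum (λ i → μ i * A i j * f j))
      ≈⟨ ∑-comm (λ j i → μ i * A i j * f j) ⟩
    sum (λ i → sum (λ j → μ i * A i j * f j))
      ≈⟨ sum-cong (λ i → sum-cong λ j → *-assoc (μ i) (A i j) (f j)) ⟩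
    sum (λ i → sum (λ j → μ i * (A i j * f j)))
      ≈⟨ sum-cong (λ i → ≈-sym (*-distribˡ-sum (μ i) (λ j → A i j * f j))) ⟩
    sum (λ i → μ i * sum (λ j → A i j * f j)) ∎
    where open SetoidReasoning setoid

  sum-nonneg : ∀ {k} {f : Vector ℝ k} → (∀ i → 0ℝ ≤ f i) → 0ℝ ≤ sum f
  sum-nonneg {zero}  f≥0 = ≤-refl
  sum-nonneg {suc k} f≥0 = ≤-trans (≈⇒≥ (+-identityˡ 0ℝ)) (+-mono-≤ (f≥0 zero) (sum-nonneg λ i → f≥0 (suc i)))

  term≤sum : ∀ {k} {f : Vector ℝ k} → (∀ i → 0ℝ ≤ f i) → ∀ i → f i ≤ sum f
  term≤sum {f = f} f≥0 zero    =
    ≤-trans (≈⇒≥ (+-identityʳ (f zero))) (+-mono-≤ ≤-refl (sum-nonneg λ i → f≥0 (suc i)))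
  term≤sum {f = f} f≥0 (suc i) =
    ≤-trans (≈⇒≥ (+-identityˡ (f (suc i)))) (+-mono-≤ (f≥0 zero) (term≤sum (λ i → f≥0 (suc i)) i))

  nonneg-sum≤0 : ∀ {k} {f : Vector ℝ k} → (∀ i → 0ℝ ≤ f i) → sum f ≤ 0ℝ → ∀ i → f i ≈ 0ℝ
  nonneg-sum≤0 f≥0 sum≤0 i = ≤-antisym (≤-trans (term≤sum f≥0 i) sum≤0) (f≥0 i)

  Positive-sum : ∀ {k} (f : Vector ℝ k) → Positive (sum f) → ∃[ i ] Positive (f i)
  Positive-sum {zero}  f pos = contradiction pos ¬Positive-0
  Positive-sum {suc k} f pos with Positive-+ (f zero) (sum (f ∘ suc)) pos
  ... | inj₁ pos₀ = zero , pos₀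
  ... | inj₂ pos₁ = let i , posᵢ = Positive-sum (f ∘ suc) pos₁ in suc i , posᵢ

  Positive-1 : Positive 1ℝ
  Positive-1 = ½ , ℚ.positive⁻¹ ½ , always λ _ → ½<1
    where
    ½<1 : ½ ℚ.< 1ℚ
    ½<1 = lin< (ℚ.positive⁻¹ ½) refl

  Positive-resp-≈ : ∀ {x y} → x ≈ y → Positive x → Positive y
  Positive-resp-≈ {x} {y} x≈y (q , q>0 , q<x) = ½ ℚ.* q , 0<½* q>0 ,
    eventually-map₂ (λ n q<xn xn<yn+½q → lin< (ℚ.<-trans q<xn xn<yn+½q) (eq q (seq y n)))
      q<x (below (≈⇒≤ x≈y) _ (0<½* q>0))
    where
    eq : ∀ q b → ½ ℚ.* q ℚ.+ (b ℚ.+ ½ ℚ.* q) ≡ b ℚ.+ q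
    eq = solve 2 (λ q b → con ½ :* q :+ (b :+ con ½ :* q) := b :+ q) refl

  Positive-difference : ∀ {p q} → p ℚ.< q → Positive (fromℚ q + - fromℚ p)
  Positive-difference {p} {q} p<q = ½ ℚ.* (q ℚ.- p) , ½gap>0 , always λ _ → lin< ½gap>0 (eq (q ℚ.- p))
    where
    eq : ∀ g → ½ ℚ.* g ℚ.+ ½ ℚ.* g ≡ g ℚ.+ 0ℚ
    eq = solve 1 (λ g → con ½ :* g :+ con ½ :* g := g :+ con 0ℚ) refl
    eq′ : ∀ p q → 0ℚ ℚ.+ q ≡ (q ℚ.- p) ℚ.+ p
    eq′ = solve 2 (λ p q → con 0ℚ :+ q := (q :- p) :+ p) refl
    ½gap>0 : 0ℚ ℚ.< ½ ℚ.* (q ℚ.- p)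
    ½gap>0 = 0<½* {q ℚ.- p} (lin< p<q (eq′ p q))

  -≥0⇒≤ : ∀ {x y} → 0ℝ ≤ y + - x → x ≤ y
  -≥0⇒≤ {x} {y} h = ≤-trans (≈⇒≥ (+-identityˡ x)) (≤-trans (+-mono-≤ h (≤-refl {x}))
    (≤-pointwise (always λ n → ℚ.≤-reflexive (eq (seq x n) (seq y n)))))
    where
    eq : ∀ a b → (b ℚ.- a) ℚ.+ a ≡ b
    eq = solve 2 (λ a b → (b :- a) :+ a := b) refl

  ≤⇒-≥0 : ∀ {x y} → x ≤ y → 0ℝ ≤ y + - x
  ≤⇒-≥0 {x} {y} x≤y = ≤-trans (≈⇒≥ (-‿inverseʳ x)) (+-mono-≤ x≤y (≤-refl { - x}))

  -- Convex hulls

  kronecker : ∀ {n} → Fin n → Fin n → ℝ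
  kronecker zero    zero    = 1ℝ
  kronecker zero    (suc k) = 0ℝ
  kronecker (suc i) zero    = 0ℝ
  kronecker (suc i) (suc k) = kronecker i k

  kronecker≥0 : ∀ {n} (i k : Fin n) → 0ℝ ≤ kronecker i k
  kronecker≥0 zero    zero    = ≤-pointwise (always λ _ → ℚ.<⇒≤ 0<1ℚ)
  kronecker≥0 zero    (suc k) = ≤-refl
  kronecker≥0 (suc i) zero    = ≤-refl
  kronecker≥0 (suc i) (suc k) = kronecker≥0 i k

  sum-kronecker : ∀ {n} (i : Fin n) (f : Vector ℝ n) → sum (λ k → kronecker i k * f k) ≈ f i
  sum-kronecker zero    f = ≈-trans (+-cong (*-identityˡ (f zero)) (sum-zero λ k → zeroˡ (f (suc k)))) (+-identityʳ (f zero))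
  sum-kronecker (suc i) f = ≈-trans (+-cong (zeroˡ (f zero)) (sum-kronecker i (f ∘ suc))) (+-identityˡ (f (suc i)))

  sum-*1 : ∀ {n} (f : Vector ℝ n) → sum f ≈ sum (λ k → f k * 1ℝ)
  sum-*1 f = sum-cong λ k → ≈-sym (*-identityʳ (f k))

  generator∈hull : ∀ {d k} (p : Vector (Point d) k) i → p i ∈ ConvexHull p
  generator∈hull p i = kronecker i , kronecker≥0 i ,
    ≈-trans (sum-*1 (kronecker i)) (sum-kronecker i λ _ → 1ℝ) ,
    λ j → sum-kronecker i λ k → p k j

  hull-minimal : ∀ {d k l} (p : Vector (Point d) k) (q : Vector (Point d) l) →
                 (∀ i → q i ∈ ConvexHull p) → ConvexHull q ⊆ ConvexHull p
  hull-minimal p q q∈p (μ , μ≥0 , sum≈1 , comb≋x) = ν , ν≥0 , sumν≈1 , λ j →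
    ≈-trans (sum-assoc μ weight (λ k → p k j))
      (≈-trans (sum-cong λ i → *-cong (≈-refl {μ i}) (proj₂ (proj₂ (proj₂ (q∈p i))) j)) (comb≋x j))
    where
    weight = λ i → proj₁ (q∈p i)
    ν = λ k → sum λ i → μ i * weight i k
    ν≥0 = λ k → sum-nonneg λ i → 0≤-* (μ≥0 i) (proj₁ (proj₂ (q∈p i)) k)
    sumν≈1 : sum ν ≈ 1ℝ
    sumν≈1 = ≈-trans (sum-*1 ν) (≈-trans (sum-assoc μ weight λ _ → 1ℝ)
      (≈-trans (sum-cong λ i → *-cong (≈-refl {μ i})
                  (≈-trans (≈-sym (sum-*1 (weight i))) (proj₁ (proj₂ (proj₂ (q∈p i))))))
               (≈-trans (≈-sym (sum-*1 μ)) sum≈1)))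

  module _ {d k} (p : Vector (Point d) k) where

    -- The slack c - a ∙ x is affine in x, so it is averaged by weights of sum 1.
    hull-slack : ∀ a c {x} ((μ , _) : x ∈ ConvexHull p) → sum (λ i → μ i * (c + - (a ∙ p i))) ≈ c + - (a ∙ x)
    hull-slack a c {x} (μ , _ , sum≈1 , comb≋x) = begin
      sum (λ i → μ i * (c + - (a ∙ p i)))
        ≈⟨ sum-cong (λ i → ≈-pointwise {μ i * (c + - (a ∙ p i))} {μ i * c + - (μ i * (a ∙ p i))}
             λ n → eq (seq (μ i) n) (seq c n) (seq (a ∙ p i) n)) ⟩
      sum (λ i → μ i * c + - (μ i * (a ∙ p i)))
        ≈⟨ ∑-distrib-+ (λ i → μ i * c) (λ i → - (μ i * (a ∙ p i))) ⟩
      sum (λ i → μ i * c) + sum (λ i → - (μ i * (a ∙ p i)))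
        ≈⟨ +-cong (≈-sym (*-distribʳ-sum c μ)) (sum-neg λ i → μ i * (a ∙ p i)) ⟩
      sum μ * c + - sum (λ i → μ i * (a ∙ p i))
        ≈⟨ +-cong (≈-trans (*-cong sum≈1 ≈-refl) (*-identityˡ c)) (neg-cong (≈-sym dual)) ⟩
      c + - (a ∙ x) ∎
      where
      open SetoidReasoning setoid
      eq : ∀ m c b → m ℚ.* (c ℚ.- b) ≡ m ℚ.* c ℚ.- m ℚ.* b
      eq = solve 3 (λ m c b → m :* (c :- b) := m :* c :- m :* b) refl
      dual : a ∙ x ≈ sum (λ i → μ i * (a ∙ p i))
      dual = ≈-trans (∙-congʳ a (≋-sym comb≋x))
        (≈-trans (sum-cong λ j → *-comm (a j) (combination μ p j))
          (≈-trans (sum-assoc μ p a) (sum-cong λ i → *-cong (≈-refl {μ i}) (sum-cong λ j → *-comm (p i j) (a j)))))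

    hull-≤ : ∀ {a c} → (∀ i → a ∙ p i ≤ c) → ∀ {x} → x ∈ ConvexHull p → a ∙ x ≤ c
    hull-≤ {a} {c} a∙p≤c h@(μ , μ≥0 , _) = -≥0⇒≤ (≤-trans
      (sum-nonneg λ i → 0≤-* (μ≥0 i) (≤⇒-≥0 (a∙p≤c i))) (≈⇒≤ (hull-slack a c h)))

    complementary-slackness : ∀ {a c} → (∀ i → a ∙ p i ≤ c) → ∀ {x} ((μ , _) : x ∈ ConvexHull p) →
      c ≤ a ∙ x → ∀ i → μ i * (c + - (a ∙ p i)) ≈ 0ℝ
    complementary-slackness {a} {c} a∙p≤c {x} h@(μ , μ≥0 , _) c≤a∙x = nonneg-sum≤0
      (λ i → 0≤-* (μ≥0 i) (≤⇒-≥0 (a∙p≤c i)))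
      (≤-trans (≈⇒≤ (hull-slack a c h)) (≤-trans (+-mono-≤ c≤a∙x (≤-refl { - (a ∙ x)})) (≈⇒≤ (-‿inverseʳ (a ∙ x)))))

    -- Weights of sum 1 include a positive one. Complementary slackness puts its generator on the
    -- face exposing x, which contains nothing but x.
    vertex⇒generator : ∀ {x} → IsVertex (ConvexHull p) x → ∃[ i ] x ≋ p i
    vertex⇒generator (F , ⊆ , ⊇) =
      let x∈P@(μ , _ , sum≈1 , _) , a∙x≈c = ⊇ ≋-refl
          i , μᵢ>0 = Positive-sum μ (Positive-resp-≈ (≈-sym sum≈1) Positive-1)
          slack≈0 = Positive-*≈0 {μ i} μᵢ>0
                      (complementary-slackness (λ i → valid (generator∈hull p i)) x∈P (≈⇒≥ a∙x≈c) i)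
      in i , ≋-sym (⊆ (generator∈hull p i , ≈-sym (-≈0⇒≈ slack≈0)))
      where open Face F using (valid)

  -- Hulls of rational points that are strictly exposed

  module _ {d k} (G : Vector (Vector ℚ d) k) (A : Vector (Vector ℚ d) k)
           (exposed : ∀ i l → i ≢ l → dot (A i) (G l) ℚ.< dot (A i) (G i)) where

    rationalPoints : Vector (Point d) k
    rationalPoints i j = fromℚ (G i j)

    private
      p = rationalPoints

      a : Vector (Point d) k
      a i j = fromℚ (A i j)

      c : Vector ℝ k
      c i = fromℚ (dot (A i) (G i))

      a∙p : ∀ i l → a i ∙ p l ≈ fromℚ (dot (A i) (G l))
      a∙p i l = ≈-pointwise λ n → seq-∙ (a i) (p l) n

      a∙p≤c : ∀ i l → a i ∙ p l ≤ c i
      a∙p≤c i l = ≤-trans (≈⇒≤ (a∙p i l)) (≤-pointwise (always λ _ → le (i Fin.≟ l)))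
        where
        le : Dec (i ≡ l) → dot (A i) (G l) ℚ.≤ dot (A i) (G i)
        le (yes refl) = ℚ.≤-refl
        le (no i≢l)   = ℚ.<⇒≤ (exposed i l i≢l)

      slack>0 : ∀ {i l} → i ≢ l → Positive (c i + - (a i ∙ p l))
      slack>0 {i} {l} i≢l = Positive-resp-≈ (+-cong (≈-refl {c i}) (neg-cong (≈-sym (a∙p i l))))
        (Positive-difference (exposed i l i≢l))

    -- Every generator other than the i-th has positive slack, hence weight 0, and the i-th carries
    -- the whole combination.
    exposed⇒only : ∀ i {x} → x ∈ ConvexHull p → c i ≤ a i ∙ x → x ≋ p i
    exposed⇒only i x∈P@(μ , _ , sum≈1 , comb≋x) c≤a∙x j = ≈-trans (≈-sym (comb≋x j))
      (≈-trans (sum-cong λ l → replace l (i Fin.≟ l))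
        (≈-trans (≈-sym (*-distribʳ-sum (p i j) μ)) (≈-trans (*-cong sum≈1 ≈-refl) (*-identityˡ (p i j)))))
      where
      replace : ∀ l → Dec (i ≡ l) → μ l * p l j ≈ μ l * p i j
      replace l (yes refl) = ≈-refl
      replace l (no i≢l)   = ≈-trans (0*-cong (p l j) μₗ≈0) (≈-sym (0*-cong (p i j) μₗ≈0))
        where
        μₗ≈0 : μ l ≈ 0ℝ
        μₗ≈0 = Positive-*≈0 {c i + - (a i ∙ p l)} (slack>0 i≢l)
          (≈-trans (*-comm (c i + - (a i ∙ p l)) (μ l)) (complementary-slackness p (a∙p≤c i) x∈P c≤a∙x l))

    exposed⇒vertex : ∀ i → IsVertex (ConvexHull p) (p i)
    exposed⇒vertex i = record { normal = a i ; offset = c i ; valid = hull-≤ p (a∙p≤c i) } ,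
      (λ (x∈P , eq) → exposed⇒only i x∈P (≈⇒≥ eq)) ,
      (λ x≋pi → hull-resp-≋ p (≋-sym x≋pi) (generator∈hull p i) , ≈-trans (∙-congʳ (a i) x≋pi) (a∙p i i))

    exposed⇒vertexSet : VertexSetIs (ConvexHull p) p
    exposed⇒vertexSet x = mk⇔ (vertex⇒generator p) λ (i , x≋pi) →
      let F , ⊆ , ⊇ = exposed⇒vertex i
      in F , (λ y∈F → ≋-trans (⊆ y∈F) (≋-sym x≋pi)) , λ y≋x → ⊇ (≋-trans y≋x x≋pi)

    exposed⇒injective : Injective _≡_ _≋_ p
    exposed⇒injective {i} {l} pi≋pl with i Fin.≟ l
    ... | yes i≡l = i≡l
    ... | no i≢l = contradiction (Positive-resp-≈ (≈-trans
        (+-cong (≈-refl {c i}) (neg-cong (≈-trans (∙-congʳ (a i) (≋-sym pi≋pl)) (a∙p i i)))) (-‿inverseʳ (c i)))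
        (slack>0 i≢l)) ¬Positive-0

  -- A polytope with 2ᵈ + 2 vertices

  sumℚ-mono-< : ∀ {n} {f g : Vector ℚ n} → (∀ i → f i ℚ.≤ g i) → ∀ i → f i ℚ.< g i → sumℚ f ℚ.< sumℚ g
  sumℚ-mono-< f≤g zero    f<g = ℚ.+-mono-<-≤ f<g (sumℚ-mono-≤ λ i → f≤g (suc i))
  sumℚ-mono-< f≤g (suc i) f<g = ℚ.+-mono-≤-< (f≤g zero) (sumℚ-mono-< (λ i → f≤g (suc i)) i f<g)

  sign : Fin 2 → ℚ
  sign zero    = 1ℚ
  sign (suc _) = ℚ.- 1ℚ

  flip : Fin 2 → Fin 2
  flip zero    = suc zero
  flip (suc _) = zero

  sign-flip : ∀ b → sign (flip b) ≡ ℚ.- sign b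
  sign-flip zero    = refl
  sign-flip (suc b) = refl

  module CubeWithSpikes (d′ : ℕ) where

    d = 2 ℕ.+ d′

    Index = Fin (2 ^ d) ⊎ Fin 2

    point : Index → Vector ℚ d
    point (inj₁ c) j       = sign (finToFun {2} {d} c j)
    point (inj₂ b) zero    = sign b ℚ.* 2ℚ
    point (inj₂ b) (suc j) = 0ℚ

    -- The smaller weight on e₀ makes the spikes fall below the supporting
    -- hyperplanes of the cube's vertices.
    functional : Index → Vector ℚ d
    functional (inj₁ c) zero    = sign (finToFun {2} {d} c zero)
    functional (inj₁ c) (suc j) = 2ℚ ℚ.* sign (finToFun {2} {d} c (suc j))
    functional (inj₂ b) zero    = sign b
    functional (inj₂ b) (suc j) = 0ℚ

    private
      cube-term-≤ : ∀ (b b′ : Fin 2) → sign b ℚ.* sign b′ ℚ.≤ sign b ℚ.* sign b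
      cube-term-≤ zero       zero       = ℚ.≤-refl
      cube-term-≤ zero       (suc zero) = from-yes (1ℚ ℚ.* ℚ.- 1ℚ ℚ.≤? 1ℚ ℚ.* 1ℚ)
      cube-term-≤ (suc zero) zero       = from-yes (ℚ.- 1ℚ ℚ.* 1ℚ ℚ.≤? ℚ.- 1ℚ ℚ.* ℚ.- 1ℚ)
      cube-term-≤ (suc zero) (suc zero) = ℚ.≤-refl

      cube-term-< : ∀ (b b′ : Fin 2) → b ≢ b′ → sign b ℚ.* sign b′ ℚ.< sign b ℚ.* sign b
      cube-term-< zero       zero       b≢b′ = contradiction refl b≢b′
      cube-term-< zero       (suc zero) _    = from-yes (1ℚ ℚ.* ℚ.- 1ℚ ℚ.<? 1ℚ ℚ.* 1ℚ)
      cube-term-< (suc zero) zero       _    = from-yes (ℚ.- 1ℚ ℚ.* 1ℚ ℚ.<? ℚ.- 1ℚ ℚ.* ℚ.- 1ℚ)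
      cube-term-< (suc zero) (suc zero) b≢b′ = contradiction refl b≢b′

      double-≤ : ∀ a x y → a ℚ.* x ℚ.≤ a ℚ.* y → (2ℚ ℚ.* a) ℚ.* x ℚ.≤ (2ℚ ℚ.* a) ℚ.* y
      double-≤ a x y h = subst₂ ℚ._≤_ (sym (ℚ.*-assoc 2ℚ a x)) (sym (ℚ.*-assoc 2ℚ a y)) (ℚ.*-monoˡ-≤-nonNeg 2ℚ h)

      double-< : ∀ a x y → a ℚ.* x ℚ.< a ℚ.* y → (2ℚ ℚ.* a) ℚ.* x ℚ.< (2ℚ ℚ.* a) ℚ.* y
      double-< a x y h = subst₂ ℚ._<_ (sym (ℚ.*-assoc 2ℚ a x)) (sym (ℚ.*-assoc 2ℚ a y)) (ℚ.*-monoʳ-<-pos 2ℚ h)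

      cube-coordinate-≤ : ∀ c c′ j → functional (inj₁ c) j ℚ.* point (inj₁ c′) j ℚ.≤ functional (inj₁ c) j ℚ.* point (inj₁ c) j
      cube-coordinate-≤ c c′ zero    = cube-term-≤ (finToFun {2} {d} c zero) (finToFun {2} {d} c′ zero)
      cube-coordinate-≤ c c′ (suc j) = double-≤ (sign (finToFun {2} {d} c (suc j))) _ _
        (cube-term-≤ (finToFun {2} {d} c (suc j)) (finToFun {2} {d} c′ (suc j)))

      cube-coordinate-< : ∀ c c′ j → finToFun {2} {d} c j ≢ finToFun {2} {d} c′ j →
        functional (inj₁ c) j ℚ.* point (inj₁ c′) j ℚ.< functional (inj₁ c) j ℚ.* point (inj₁ c) j
      cube-coordinate-< c c′ zero    ne = cube-term-< (finToFun {2} {d} c zero) (finToFun {2} {d} c′ zero) ne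
      cube-coordinate-< c c′ (suc j) ne = double-< (sign (finToFun {2} {d} c (suc j))) _ _
        (cube-term-< (finToFun {2} {d} c (suc j)) (finToFun {2} {d} c′ (suc j)) ne)

      differing-coordinate : ∀ c c′ → c ≢ c′ → ∃[ j ] finToFun {2} {d} c j ≢ finToFun {2} {d} c′ j
      differing-coordinate c c′ c≢c′ = Fin.¬∀⟶∃¬ d _ (λ j → finToFun {2} {d} c j Fin.≟ finToFun {2} {d} c′ j)
        λ same → c≢c′ (trans (sym (Fin.funToFin-finToFin {d} {2} c))
          (trans (funToFin-cong same) (Fin.funToFin-finToFin {d} {2} c′)))
        where
        funToFin-cong : ∀ {m n} {f g : Fin m → Fin n} → (∀ j → f j ≡ g j) → funToFin f ≡ funToFin g
        funToFin-cong {zero}  f≗g = refl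
        funToFin-cong {suc m} f≗g = cong₂ combine (f≗g zero) (funToFin-cong λ j → f≗g (suc j))

      -- The first two coordinates decide: the spike scores at most 2, the cube vertex 1 + 2. The
      -- second coordinate is where d ≥ 2 is used.
      spike-below-cube : ∀ (b s₀ s₁ : Fin 2) →
        sign s₀ ℚ.* (sign b ℚ.* 2ℚ) ℚ.+ (2ℚ ℚ.* sign s₁) ℚ.* 0ℚ ℚ.<
        sign s₀ ℚ.* sign s₀ ℚ.+ (2ℚ ℚ.* sign s₁) ℚ.* sign s₁
      spike-below-cube b s₀ s₁ = from-yes (Fin.all? λ b → Fin.all? λ s₀ → Fin.all? λ s₁ →
        sign s₀ ℚ.* (sign b ℚ.* 2ℚ) ℚ.+ (2ℚ ℚ.* sign s₁) ℚ.* 0ℚ ℚ.<?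
        sign s₀ ℚ.* sign s₀ ℚ.+ (2ℚ ℚ.* sign s₁) ℚ.* sign s₁) b s₀ s₁

      cube-below-spike : ∀ (b s : Fin 2) → sign b ℚ.* sign s ℚ.< sign b ℚ.* (sign b ℚ.* 2ℚ)
      cube-below-spike = from-yes (Fin.all? λ b → Fin.all? λ s →
        sign b ℚ.* sign s ℚ.<? sign b ℚ.* (sign b ℚ.* 2ℚ))

      spikes-apart : ∀ (b b′ : Fin 2) → b ≢ b′ → sign b ℚ.* (sign b′ ℚ.* 2ℚ) ℚ.< sign b ℚ.* (sign b ℚ.* 2ℚ)
      spikes-apart zero       zero       b≢b′ = contradiction refl b≢b′
      spikes-apart zero       (suc zero) _    = from-yes (1ℚ ℚ.* (ℚ.- 1ℚ ℚ.* 2ℚ) ℚ.<? 1ℚ ℚ.* (1ℚ ℚ.* 2ℚ))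
      spikes-apart (suc zero) zero       _    = from-yes (ℚ.- 1ℚ ℚ.* (1ℚ ℚ.* 2ℚ) ℚ.<? ℚ.- 1ℚ ℚ.* (ℚ.- 1ℚ ℚ.* 2ℚ))
      spikes-apart (suc zero) (suc zero) b≢b′ = contradiction refl b≢b′

      square≥0 : ∀ (s : Fin 2) → (2ℚ ℚ.* sign s) ℚ.* 0ℚ ℚ.≤ (2ℚ ℚ.* sign s) ℚ.* sign s
      square≥0 = from-yes (Fin.all? λ s → (2ℚ ℚ.* sign s) ℚ.* 0ℚ ℚ.≤? (2ℚ ℚ.* sign s) ℚ.* sign s)

    point-exposed : ∀ i l → i ≢ l → dot (functional i) (point l) ℚ.< dot (functional i) (point i)
    point-exposed (inj₁ c) (inj₁ c′) c≢c′ =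
      let j , differ = differing-coordinate c c′ (c≢c′ ∘ cong inj₁)
      in sumℚ-mono-< (cube-coordinate-≤ c c′) j (cube-coordinate-< c c′ j differ)
    point-exposed (inj₁ c) (inj₂ b) _ = subst₂ ℚ._<_
      (ℚ.+-assoc (f zero ℚ.* g zero) (f one ℚ.* g one) (sumℚ λ j → f (suc (suc j)) ℚ.* g (suc (suc j))))
      (ℚ.+-assoc (f zero ℚ.* h zero) (f one ℚ.* h one) (sumℚ λ j → f (suc (suc j)) ℚ.* h (suc (suc j))))
      (ℚ.+-mono-<-≤ (spike-below-cube b (finToFun {2} {d} c zero) (finToFun {2} {d} c one))
                    (sumℚ-mono-≤ λ j → square≥0 (finToFun {2} {d} c (suc (suc j)))))
      where
      f = functional (inj₁ c)
      g = point (inj₂ b)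
      h = point (inj₁ c)
      one : Fin d
      one = suc zero
    point-exposed (inj₂ b) (inj₁ c) _ = ℚ.+-mono-<-≤ (cube-below-spike b (finToFun {2} {d} c zero))
      (sumℚ-mono-≤ λ j → ℚ.≤-reflexive (ℚ.*-zeroˡ (point (inj₁ c) (suc j))))
    point-exposed (inj₂ b) (inj₂ b′) b≢b′ = ℚ.+-monoˡ-< (sumℚ λ j → functional (inj₂ b) (suc j) ℚ.* point (inj₂ b) (suc j))
      (spikes-apart b b′ (b≢b′ ∘ cong inj₂))

    antipode : Index → Index
    antipode (inj₁ c) = inj₁ (funToFin (flip ∘ finToFun {2} {d} c))
    antipode (inj₂ b) = inj₂ (flip b)

    point-antipode : ∀ i j → point (antipode i) j ≡ ℚ.- point i j
    point-antipode (inj₁ c) j       = trans (cong sign (Fin.finToFun-funToFin (flip ∘ finToFun {2} {d} c) j))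
                                        (sign-flip (finToFun {2} {d} c j))
    point-antipode (inj₂ b) zero    = trans (cong (ℚ._* 2ℚ) (sign-flip b)) (sym (ℚ.neg-distribˡ-* (sign b) 2ℚ))
    point-antipode (inj₂ b) (suc j) = refl

    N = 2 ^ d ℕ.+ 2

    private
      G A : Vector (Vector ℚ d) N
      G = point ∘ splitAt (2 ^ d)
      A = functional ∘ splitAt (2 ^ d)

      exposed : ∀ i l → i ≢ l → dot (A i) (G l) ℚ.< dot (A i) (G i)
      exposed i l i≢l = point-exposed (splitAt (2 ^ d) i) (splitAt (2 ^ d) l) λ eq →
        i≢l (trans (sym (Fin.join-splitAt (2 ^ d) 2 i)) (trans (cong (join (2 ^ d) 2) eq) (Fin.join-splitAt (2 ^ d) 2 l)))

    vertices : Vector (Point d) N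
    vertices = rationalPoints G A exposed

    polytope : Polytope d
    polytope = record { size = N ; generators = vertices }

    vertexAt : Index → Fin N
    vertexAt = join (2 ^ d) 2

    vertices-at : ∀ i j → vertices (vertexAt i) j ≈ fromℚ (point i j)
    vertices-at i j = ≈-pointwise λ n → cong (λ i → point i j) (Fin.splitAt-join (2 ^ d) 2 i)

    -- The same weights represent the negated point over the negated generators, and these are
    -- generators again.
    symmetric : CentrallySymmetric polytope
    symmetric x (μ , μ≥0 , sum≈1 , comb≋x) = hull-minimal vertices (-ᵛ_ ∘ vertices) -v∈P
      (μ , μ≥0 , sum≈1 , λ j → ≈-trans
        (sum-cong λ i → ≈-pointwise {μ i * - vertices i j} { - (μ i * vertices i j)} λ n → sym (ℚ.neg-distribʳ-* (seq (μ i) n) (G i j)))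
        (≈-trans (sum-neg λ i → μ i * vertices i j) (neg-cong (comb≋x j))))
      where
      -v∈P : ∀ i → -ᵛ vertices i ∈ ConvexHull vertices
      -v∈P i = hull-resp-≋ vertices (λ j → ≈-trans (vertices-at (antipode (splitAt (2 ^ d) i)) j)
                                            (≈-pointwise λ n → point-antipode (splitAt (2 ^ d) i) j))
                 (generator∈hull vertices (vertexAt (antipode (splitAt (2 ^ d) i))))

    vertexCount : HasVertexCount (carrier polytope) N
    vertexCount = vertices , exposed⇒injective G A exposed , exposed⇒vertexSet G A exposed

    private
      bit : ∀ {n} → Fin n → Fin n → Fin 2
      bit zero    zero    = suc zero
      bit zero    (suc k) = zero
      bit (suc j) zero    = zero
      bit (suc j) (suc k) = bit j k

      sign-bit : ∀ {n} (j k : Fin n) → fromℚ (sign (bit j k)) ≈ 1ℝ + - (fromℚ 2ℚ * kronecker j k)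
      sign-bit zero    zero    = ≈-pointwise λ n → refl
      sign-bit zero    (suc k) = ≈-pointwise λ n → refl
      sign-bit (suc j) zero    = ≈-pointwise λ n → refl
      sign-bit (suc j) (suc k) = sign-bit j k

    -- The vertex (1, …, 1) of the cube and its d neighbours.
    basis : Vector (Point d) (suc d)
    basis zero    = vertices (vertexAt (inj₁ (funToFin {d} {2} λ _ → zero)))
    basis (suc k) = vertices (vertexAt (inj₁ (funToFin {d} {2} λ j → bit j k)))

    private
      basis₀ : ∀ j → basis zero j ≈ 1ℝ
      basis₀ j = ≈-trans (vertices-at (inj₁ (funToFin {d} {2} λ _ → zero)) j)
        (≈-pointwise λ n → cong sign (Fin.finToFun-funToFin {d} {2} (λ _ → zero) j))

      basis₊ : ∀ k j → basis (suc k) j ≈ 1ℝ + - (fromℚ 2ℚ * kronecker j k)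
      basis₊ k j = ≈-trans (vertices-at (inj₁ (funToFin {d} {2} λ j → bit j k)) j)
        (≈-trans (≈-pointwise λ n → cong sign (Fin.finToFun-funToFin {d} {2} (λ j → bit j k) j)) (sign-bit j k))

    -- Coordinate j is 1 at every basis point except at number `suc j`, where it is -1. Solving for
    -- `μ (suc j)` gives both independence and spanning.
    basis-combination : ∀ μ j → combination μ basis j ≈ sum μ + - (fromℚ 2ℚ * μ (suc j))
    basis-combination μ j = begin
      μ zero * basis zero j + sum (λ k → μ (suc k) * basis (suc k) j)
        ≈⟨ +-cong (≈-trans (*-cong (≈-refl {μ zero}) (basis₀ j)) (*-identityʳ (μ zero)))
                  (sum-cong λ k → ≈-trans (*-cong (≈-refl {μ (suc k)}) (basis₊ k j))
                    (≈-pointwise {μ (suc k) * (1ℝ + - (fromℚ 2ℚ * kronecker j k))} {μ (suc k) + - (fromℚ 2ℚ) * (kronecker j k * μ (suc k))}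
                       λ n → eq (seq (μ (suc k)) n) (seq (kronecker j k) n))) ⟩
      μ zero + sum (λ k → μ (suc k) + - (fromℚ 2ℚ) * (kronecker j k * μ (suc k)))
        ≈⟨ +-cong (≈-refl {μ zero}) (≈-trans (∑-distrib-+ (μ ∘ suc) (λ k → - (fromℚ 2ℚ) * (kronecker j k * μ (suc k))))
             (+-cong (≈-refl {sum (μ ∘ suc)}) (≈-sym (*-distribˡ-sum (- (fromℚ 2ℚ)) (λ k → kronecker j k * μ (suc k)))))) ⟩
      μ zero + (sum (μ ∘ suc) + - (fromℚ 2ℚ) * sum (λ k → kronecker j k * μ (suc k)))
        ≈⟨ +-cong (≈-refl {μ zero}) (+-cong (≈-refl {sum (μ ∘ suc)}) (*-cong (≈-refl { - (fromℚ 2ℚ)}) (sum-kronecker j (μ ∘ suc)))) ⟩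
      μ zero + (sum (μ ∘ suc) + - (fromℚ 2ℚ) * μ (suc j))
        ≈⟨ ≈-pointwise {μ zero + (sum (μ ∘ suc) + - (fromℚ 2ℚ) * μ (suc j))} {sum μ + - (fromℚ 2ℚ * μ (suc j))}
             (λ n → eq′ (seq (μ zero) n) (seq (sum (μ ∘ suc)) n) (seq (μ (suc j)) n)) ⟩
      sum μ + - (fromℚ 2ℚ * μ (suc j)) ∎
      where
      open SetoidReasoning setoid
      eq : ∀ m k → m ℚ.* (1ℚ ℚ.- 2ℚ ℚ.* k) ≡ m ℚ.+ (ℚ.- 2ℚ) ℚ.* (k ℚ.* m)
      eq = solve 2 (λ m k → m :* (con 1ℚ :- con 2ℚ :* k) := m :+ (:- con 2ℚ) :* (k :* m)) refl
      eq′ : ∀ a s m → a ℚ.+ (s ℚ.+ (ℚ.- 2ℚ) ℚ.* m) ≡ (a ℚ.+ s) ℚ.- 2ℚ ℚ.* m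
      eq′ = solve 3 (λ a s m → a :+ (s :+ (:- con 2ℚ) :* m) := (a :+ s) :- con 2ℚ :* m) refl

    basis-independent : AffinelyIndependent basis
    basis-independent μ sum≈0 comb≈0 = λ { zero → μ₀≈0 ; (suc j) → μ₊≈0 j }
      where
      μ₊≈0 : ∀ j → μ (suc j) ≈ 0ℝ
      μ₊≈0 j = Positive-*≈0 {fromℚ 2ℚ} Positive-2 (≈-sym (≈-trans (≈-sym sum≈0) (-≈0⇒≈
        (≈-trans (≈-sym (basis-combination μ j)) (comb≈0 j)))))
      μ₀≈0 : μ zero ≈ 0ℝ
      μ₀≈0 = ≈-trans (≈-sym (+-identityʳ (μ zero)))
        (≈-trans (+-cong (≈-refl {μ zero}) (≈-sym (sum-zero μ₊≈0))) sum≈0)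

    basis-spans : ∀ x → x ∈ AffineHull basis
    basis-spans x = μ , sum≈1 , λ j → ≈-trans (basis-combination μ j)
      (≈-trans (+-cong sum≈1 (≈-refl { - (fromℚ 2ℚ * ν j)})) (≈-pointwise λ n → eq (seq (x j) n)))
      where
      ν : Vector ℝ d
      -- The solution of 1 - 2ν = x in each coordinate. The weight of the all-ones vertex then
      -- completes the sum to 1.
      ν j = fromℚ ½ * (1ℝ + - x j)
      μ : Vector ℝ (suc d)
      μ = (1ℝ + - sum ν) ∷ ν
      sum≈1 : sum μ ≈ 1ℝ
      sum≈1 = ≈-pointwise {sum μ} {1ℝ} λ n → eq′ (seq (sum ν) n)
        where
        eq′ : ∀ s → (1ℚ ℚ.- s) ℚ.+ s ≡ 1ℚ
        eq′ = solve 1 (λ s → (con 1ℚ :- s) :+ s := con 1ℚ) refl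
      eq : ∀ x → 1ℚ ℚ.- 2ℚ ℚ.* (½ ℚ.* (1ℚ ℚ.- x)) ≡ x
      eq = solve 1 (λ x → con 1ℚ :- con 2ℚ :* (con ½ :* (con 1ℚ :- x)) := x) refl

    fullDimensional : HasDimension (carrier polytope) d
    fullDimensional = basis , basis∈P , basis-independent , λ {x} _ → basis-spans x
      where
      basis∈P : ∀ i → basis i ∈ carrier polytope
      basis∈P zero    = generator∈hull vertices (vertexAt (inj₁ (funToFin {d} {2} λ _ → zero)))
      basis∈P (suc k) = generator∈hull vertices (vertexAt (inj₁ (funToFin {d} {2} λ j → bit j k)))

    -- A family of one vertex spans the face that exposes it, and within that face the same
    -- functional exposes it again.
    oneNeighborly : ∀ {m} → 2 ℕ.* m ≡ N → Neighborly 1 m polytope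
    oneNeighborly {m} 2m≡N = record
      { symmetric = symmetric
      ; vertexCount = subst (HasVertexCount (carrier polytope)) (sym 2m≡N) vertexCount
      ; 1≤k = s≤s z≤n
      ; k≤m = 1≤m m 2m≡N
      ; faces = λ w _ w-vertex _ →
          let F , ⊆ , ⊇ = w-vertex zero
          in F , λ x → mk⇔ (λ x-vertex → zero , ⊆ (vertex∈ x-vertex)) λ { (zero , x≋w) →
               record { normal = Face.normal F ; offset = Face.offset F ; valid = λ (y∈P , _) → Face.valid F y∈P } ,
               (λ (y∈F , _) → ≋-trans (⊆ y∈F) (≋-sym x≋w)) ,
               (λ y≋x → ⊇ (≋-trans y≋x x≋w) , proj₂ (⊇ (≋-trans y≋x x≋w))) ; (suc () , _) } }
      where
      1≤m : ∀ m → 2 ℕ.* m ≡ N → 1 ℕ.≤ m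
      1≤m zero    0≡N = contradiction (trans 0≡N (ℕ.+-comm (2 ^ d) 2)) λ ()
      1≤m (suc m) _   = s≤s z≤n

  n<2^n : ∀ n → n ℕ.< 2 ^ n
  n<2^n zero    = s≤s z≤n
  n<2^n (suc n) = ℕ.≤-trans (ℕ.+-mono-≤ (ℕ.m^n>0 2 n) (n<2^n n)) (ℕ.≤-reflexive (cong (2 ^ n ℕ.+_) (sym (ℕ.+-identityʳ (2 ^ n)))))

open import Data.Nat.Base using (_+_; _*_; _∸_; _^_; _≤_)

theorem1p2 : ∀ d → 2 ≤ d →
    (k[ d , (2 ^ (d ∸ 1) + 1) ∸ d ]≔ 1) ×
    (∀ (P : Polytope d) m → HasDimension (carrier P) d → Neighborly 2 m P → 2 * m ≤ 2 ^ d)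
theorem1p2 d@(suc (suc d′)) 2≤d =
  ((polytope , fullDimensional , oneNeighborly 2m≡N) , λ j (P , _ , neighborly) → ℕ.≮⇒≥ λ 2≤j →
      ℕ.<⇒≱ (ℕ.m<m+n (2 ^ d) (s≤s z≤n)) (subst (_≤ 2 ^ d) 2m≡N (neighborly⇒bound 2≤j neighborly))) ,
  λ P m _ neighborly → neighborly⇒bound ℕ.≤-refl neighborly
  where
  open CubeWithSpikes d′ using (N; polytope; fullDimensional; oneNeighborly)
  -- This makes the truncated subtraction exact, so that n + d is 2ᵈ⁻¹ + 1, half the number of
  -- vertices.
  d≤ : d ≤ 2 ^ suc d′ + 1
  d≤ = ℕ.≤-trans (n<2^n (suc d′)) (ℕ.m≤m+n (2 ^ suc d′) 1)
  2m≡N : 2 * ((2 ^ suc d′ + 1) ∸ d + d) ≡ N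
  2m≡N = trans (cong (2 *_) (ℕ.m∸n+n≡m d≤)) (ℕ.*-distribˡ-+ 2 (2 ^ suc d′) 1)
theorem1p2 (suc zero) (s≤s ())
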